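{- For every graph \(G\) on \(n\) vertices, every tree decomposition \((T,\mathcal{X})\) of \(G\) of width \(t-1\), and every \(m\in\{1,\dots,n\}\), there is a partition \((B,W)\) of \(V(G)\) with \(|B|=m\) and \[e_G(B,W)\leq \tfrac12 t\,\Delta(G)\left(\left(\log_2 \tfrac{1}{r(T,\mathcal{X})}\right)^2 + 9\log_2\tfrac{1}{r(T,\mathcal{X})} + 8\right).\]
   Context: \(e_G(B,W)\) is the number of edges with one end in \(B\) and the other in \(W\); \(\Delta(G)\) is the maximum degree. A tree decomposition of \(G\) is a pair \((T,\mathcal{X})\) where \(T\) is a tree and \(\mathcal{X}=(X^i)_{i\in V(T)}\) with \(X^i\subseteq V(G)\), such that every vertex of \(G\) lies in some \(X^i\), every edge of \(G\) is contained in some \(X^i\), and for all nodes \(i,j\) and every node \(h\) on the \(i\)–\(j\) path in \(T\), \(X^i\cap X^j\subseteq X^h\). Its width is \(\max_i|X^i|-1\). For a path \(P\subseteq T\), \(w^*(P,\mathcal{X}) := |\bigcup_{i\in V(P)}X^i|/n\), and \(r(T,\mathcal{X}) := \max_{P\text{ path in }T} w^*(P,\mathcal{X})\). -}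

module Defs where

open import Data.Nat using (ℕ; zero; suc; _+_; _*_; _^_; _≤_; _<_; _⊔_)
open import Data.Bool using (Bool; true; false; T)
open import Data.Fin using (Fin)
open import Data.Fin.Subset using (Subset; _∈_; _∉_; _∪_; ∣_∣; ∁) renaming (⊥ to ∅)
open import Data.List using (List; []; _∷_; map; foldr; head; last; length; filter)
open import Data.Nat.ListAction using (sum)
open import Data.List.Relation.Unary.Linked using (Linked)
open import Data.List.Relation.Unary.Unique.Propositional using (Unique)
open import Data.List.Membership.Propositional renaming (_∈_ to _∈ₗ_)
open import Data.List.Base using (allFin)
open import Data.Maybe using (just)
open import Data.Product using (Σ; ∃; _×_; _,_)
open import Relation.Binary.PropositionalEquality using (_≡_)

record Graph (n : ℕ) : Set where
  field
    adj    : Fin n → Fin n → Bool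
    sym    : ∀ u v → adj u v ≡ adj v u
    irrefl : ∀ v → adj v v ≡ false
open Graph public

Edge : ∀ {n} → Graph n → Fin n → Fin n → Set
Edge G u v = T (adj G u v)

count : ∀ {n} → (Fin n → Bool) → ℕ
count {n} f = length (filter (λ i → Data.Bool._≟_ (f i) true) (allFin n))

degree : ∀ {n} → Graph n → Fin n → ℕ
degree G v = count (adj G v)

maxDegree : ∀ {n} → Graph n → ℕ
maxDegree {n} G = foldr _⊔_ 0 (map (degree G) (allFin n))

-- e_G(B, W) with W = complement of B: number of ordered pairs (u , v) with
-- u ∈ B, v ∉ B, uv ∈ E(G); each such edge is counted exactly once.
inB : ∀ {n} → Subset n → Fin n → Bool
inB B u = Data.Vec.Base.lookup B u
  where import Data.Vec.Base

edgesBetween : ∀ {n} → Graph n → Subset n → ℕ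
edgesBetween {n} G B =
  sum (map (λ u → count (λ v → Data.Bool._∧_ (inB B u)
                        (Data.Bool._∧_ (Data.Bool.not (inB B v)) (adj G u v))))
           (allFin n))

IsPath : ∀ {n} → Graph n → List (Fin n) → Set
IsPath G xs = Linked (Edge G) xs × Unique xs × (1 ≤ length xs)

PathFromTo : ∀ {n} → Graph n → Fin n → Fin n → List (Fin n) → Set
PathFromTo G u v xs = IsPath G xs × head xs ≡ just u × last xs ≡ just v

Connected : ∀ {n} → Graph n → Set
Connected G = ∀ u v → ∃ λ xs → PathFromTo G u v xs

IsCycle : ∀ {n} → Graph n → List (Fin n) → Set
IsCycle G xs = Linked (Edge G) xs × Unique xs × (3 ≤ length xs)
             × (∃ λ u → ∃ λ v → head xs ≡ just u × last xs ≡ just v × Edge G v u)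

Acyclic : ∀ {n} → Graph n → Set
Acyclic G = ∀ xs → IsCycle G xs → Data.Empty.⊥
  where import Data.Empty

IsTree : ∀ {k} → Graph k → Set
IsTree T = Connected T × Acyclic T

record IsTreeDecomposition {n k : ℕ} (G : Graph n) (T : Graph k)
                           (X : Fin k → Subset n) : Set where
  field
    tree      : IsTree T
    coverV    : ∀ v → ∃ λ i → v ∈ X i
    coverE    : ∀ u v → Edge G u v → ∃ λ i → u ∈ X i × v ∈ X i
    coherence : ∀ i j h → (∀ xs → PathFromTo T i j xs → h ∈ₗ xs)
                → ∀ v → v ∈ X i → v ∈ X j → v ∈ X h

-- maximum bag size; the width is maxBag - 1
maxBag : ∀ {n k} → (Fin k → Subset n) → ℕ
maxBag {k = k} X = foldr _⊔_ 0 (map (λ i → ∣ X i ∣) (allFin k))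

unionSize : ∀ {n k} → (Fin k → Subset n) → List (Fin k) → ℕ
unionSize X P = ∣ foldr _∪_ ∅ (map X P) ∣

-- "log₂ (1/r(T,X)) ≥ p/q", i.e. 2^(p/q) ≤ n / max_P |⋃_{i∈P} X i|,
-- i.e. 2^p · |⋃_P X|^q ≤ n^q for every path P in T.
Log2InvRAtLeast : ∀ {n k} → Graph k → (Fin k → Subset n) → ℕ → ℕ → Set
Log2InvRAtLeast {n} T X p q =
  ∀ P → IsPath T P → 2 ^ p * unionSize X P ^ q ≤ n ^ q

-- e ≤ ½ t Δ (L² + 9L + 8) with L = log₂(1/r(T,X)), expressed without reals:
-- for every nonnegative rational a = p/q with ½ t Δ (a² + 9a + 8) < e, we have a ≤ L.
-- (Equivalent since a ↦ a² + 9a + 8 is continuous and increasing on [0,∞) and L ≥ 0.)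
BoundedByLogExpr : ∀ {n k} → Graph k → (Fin k → Subset n) → (t Δ e : ℕ) → Set
BoundedByLogExpr T X t Δ e =
  ∀ p q → 1 ≤ q →
    t * Δ * (p * p + 9 * p * q + 8 * q * q) < 2 * e * (q * q) →
    Log2InvRAtLeast T X p q

{-# OPTIONS --safe #-}
module Submission where

-- Fix a path P of T whose bags contain as many vertices as possible, say R of the n vertices, and
-- root T at an end of P.  Every vertex belongs to the topmost node whose bag contains it, so V(G)
-- splits into consecutive blocks along P: the own (new) vertices of a path node, followed by those
-- of the subtrees hanging off it.  All edges of the cuts constructed here are incident with K
-- bags, whence e(B, W) ≤ K t Δ, and it remains to keep K ≤ ½ (L² + 9 L + 8) for L = log₂ (n / R).
--
-- Arrange the blocks on a circle.  An interval that starts and ends at own vertices costs two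
-- bags, and greedily splitting off subtrees cuts a part of size at most w out of a hanging tree
-- with error w / 2ʲ at the price of j bags.  Compare the circle with its shift by m.  Where a block t
-- starts opposite to a block having M further vertices, we are done at once if t has at least
-- (R / n) M own vertices: the required size is matched by cutting the opposite block up to that
-- error.  Otherwise consider the run F of blocks lying entirely opposite to t.  If F has at least
-- twice the density R / n of own vertices and is not too short, cut t approximately and recurse on
-- F: L drops by 1, which pays for L + 4 bags.  If this fails as well, the stretch from the start of
-- t to the end of F has fewer than 2 R / n own vertices per position, counting both sides, and we
-- continue with the block after F.  This cannot go on around the circle, as the average is 2 R / n.

open import Defs hiding (sym)
import Algebra.Solver.CommutativeMonoid as CommutativeMonoidSolver
open import Data.Bool using (Bool; true; false; T; T?; not; _∧_)
import Data.Bool as Bool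
open import Data.Empty using (⊥-elim)
open import Data.Fin using (Fin; fromℕ<)
open import Data.Fin.Properties using (_≟_)
open import Data.Fin.Subset using (Subset; _∈_; _∉_; _∪_; ∣_∣) renaming (⊥ to ∅)
open import Data.Fin.Subset.Properties using (_∈?_; x∈p∪q⁻; x∈p∪q⁺; ∉⊥)
open import Data.List using (List; []; _∷_; _++_; length; filter; map; foldr; head; last; allFin; tabulate; cartesianProductWith; initLast; _∷ʳ′_)
open import Data.List.Extrema.Nat using (argmax; argmax-all; f[xs]≤f[argmax])
open import Data.List.Membership.Propositional using () renaming (_∈_ to _∈ₗ_; _∉_ to _∉ₗ_)
open import Data.List.Membership.Propositional.Properties using (∈-∃++; ∈-++⁻; ∈-++⁺ˡ; ∈-++⁺ʳ; ∈-filter⁺; ∈-filter⁻; ∈-allFin; ∈-cartesianProductWith⁺)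
open import Data.List.Membership.Propositional.Properties.WithK using (unique∧set⇒bag)
open import Data.List.Properties using (length-++; length-tabulate; ++-assoc; ++-identityʳ; ∷ʳ-injectiveʳ; ∷-injectiveʳ; filter-++; filter-all; filter-none; map-tabulate; map-cong)
open import Data.List.Relation.Binary.BagAndSetEquality using (∼bag⇒↭)
open import Data.List.Relation.Binary.Permutation.Propositional using (_↭_; ↭-refl; ↭-sym; ↭-trans; ↭-reflexive; ↭⇒↭ₛ; prep; swap)
open import Data.List.Relation.Binary.Permutation.Propositional.Properties using (++⁺; ++⁺ˡ; ++⁺ʳ; ++-comm; ++-commutativeMonoid; ↭-length; ∈-resp-↭; filter-↭; shift)
import Data.List.Relation.Binary.Permutation.Setoid.Properties as Permₛ
open import Data.List.Relation.Binary.Sublist.Propositional using (_⊆_; _∷ʳ_; _∷_; []; ⊆-refl; ⊆-trans; from∈; to∈; minimum)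
open import Data.List.Relation.Binary.Sublist.Propositional.Properties using (∷ˡ⁻) renaming (++⁺ to ⊆-++⁺; ++⁺ˡ to ⊆-++⁺ˡ; ++⁺ʳ to ⊆-++⁺ʳ)
open import Data.List.Relation.Unary.All as All using (All; []; _∷_)
import Data.List.Relation.Unary.All.Properties as Allₚ
open import Data.List.Relation.Unary.AllPairs using ([]; _∷_)
open import Data.List.Relation.Unary.Any as Any using (Any; here; there)
import Data.List.Relation.Unary.Any.Properties as Anyₚ
open import Data.List.Relation.Unary.Linked using (Linked; []; [-]; _∷_; linked?)
import Data.List.Relation.Unary.Unique.DecPropositional as DecUnique
open import Data.List.Relation.Unary.Unique.Propositional using (Unique)
import Data.List.Relation.Unary.Unique.Propositional.Properties as Uniqueₚ
open import Data.Maybe using (just)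
open import Data.Maybe.Properties using (just-injective)
open import Data.Nat using (ℕ; zero; suc; _+_; _*_; _^_; _≤_; _<_; _⊔_; z≤n; s≤s; _≤?_; _<?_; >-nonZero)
open import Data.Nat.Induction using (<-wellFounded)
open import Data.Nat.ListAction using (sum)
open import Data.Nat.Properties hiding (_≟_; _≤?_; _<?_)
open import Data.Nat.Tactic.RingSolver using (solve-∀)
open import Data.Product using (∃; ∃₂; _×_; _,_; proj₁; proj₂)
open import Data.Sum as Sum using (_⊎_; inj₁; inj₂; [_,_]′)
open import Data.Unit using (⊤; tt)
open import Data.Vec using ([]; _∷_; lookup) renaming (tabulate to tabulateᵛ)
open import Data.Vec.Properties using (lookup⇒[]=; []=⇒lookup; lookup∘tabulate)
open import Function using (_∘_; id; mk⇔)
open import Induction.WellFounded using (Acc; acc)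
open import Relation.Binary.PropositionalEquality
open import Relation.Nullary using (Dec; yes; no; does; ¬_)
open import Relation.Nullary.Decidable using (_×-dec_; ¬?; dec-true)
open import Relation.Unary using (Decidable)

-- K ≤ ½ (L² + 9 L + 8) for L = log₂ (N / R), expressed through the rationals p / q > L.
LogBound : (N R K : ℕ) → Set
LogBound N R K = ∀ p q → 1 ≤ q → N ^ q < 2 ^ p * R ^ q →
  2 * K * (q * q) ≤ p * p + 9 * p * q + 8 * q * q

-- Implies j ≤ 1 + log₂ (N / R).
Depth : (N R j : ℕ) → Set
Depth N R j = j ≡ 0 ⊎ ∃ λ i → j ≡ suc i × 2 ^ i * R < N

-- Arithmetic of the logarithmic bound and of rounding depths.

*-^-distrib : ∀ a b q → (a * b) ^ q ≡ a ^ q * b ^ q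
*-^-distrib a b zero = refl
*-^-distrib a b (suc q) rewrite *-^-distrib a b q = ring a b (a ^ q) (b ^ q)
  where
  ring : ∀ x y z w → x * y * (z * w) ≡ x * z * (y * w)
  ring = solve-∀

-- For `j = i + 1`, the inequality `2 ^ i * R < N` puts `i` below the logarithm of `N / R`, of which
-- `p / q` is an upper estimate. The extra `q` pays for rounding up to a whole exponent.
depth-bound : ∀ {N R j} p q → Depth N R j → N ^ q < 2 ^ p * R ^ q → j * q ≤ p + q
depth-bound p q (inj₁ refl) _ = z≤n
depth-bound {N} {R} p q (inj₂ (i , refl , lt)) h =
  subst (q + i * q ≤_) (+-comm q p) (+-monoʳ-≤ q (≮⇒≥ λ p<iq → <-irrefl refl (contra (<⇒≤ p<iq))))
  where
  open ≤-Reasoning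
  contra : p ≤ i * q → N ^ q < N ^ q
  contra le = begin-strict
    N ^ q                <⟨ h ⟩
    2 ^ p * R ^ q        ≤⟨ *-monoˡ-≤ (R ^ q) (^-monoʳ-≤ 2 le) ⟩
    2 ^ (i * q) * R ^ q  ≡⟨ cong (_* R ^ q) (sym (^-*-assoc 2 i q)) ⟩
    (2 ^ i) ^ q * R ^ q  ≡⟨ sym (*-^-distrib (2 ^ i) R q) ⟩
    (2 ^ i * R) ^ q      ≤⟨ ^-monoˡ-≤ q (<⇒≤ lt) ⟩
    N ^ q                ∎

-- As `j ≤ 1 + L`, having `2 + j` bags gives `2 K ≤ 6 + 2 L`, well within `L² + 9 L + 8`.
logBound-direct : ∀ {N R j K} → Depth N R j → K ≤ 2 + j → LogBound N R K
logBound-direct {N} {R} {j} {K} dep K≤ p q _ h = begin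
  2 * K * (q * q)                   ≤⟨ *-monoˡ-≤ (q * q) (*-monoʳ-≤ 2 K≤) ⟩
  2 * (2 + j) * (q * q)             ≡⟨ e₁ j q ⟩
  4 * (q * q) + 2 * q * (j * q)     ≤⟨ +-monoʳ-≤ (4 * (q * q)) (*-monoʳ-≤ (2 * q) (depth-bound {N} {R} {j} p q dep h)) ⟩
  4 * (q * q) + 2 * q * (p + q)     ≤⟨ m≤m+n _ (p * p + 7 * p * q + 2 * q * q) ⟩
  4 * (q * q) + 2 * q * (p + q) + (p * p + 7 * p * q + 2 * q * q) ≡⟨ e₂ p q ⟩
  p * p + 9 * p * q + 8 * q * q     ∎
  where
  open ≤-Reasoning
  e₁ : ∀ j q → 2 * (2 + j) * (q * q) ≡ 4 * (q * q) + 2 * q * (j * q)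
  e₁ = solve-∀
  e₂ : ∀ p q → 4 * (q * q) + 2 * q * (p + q) + (p * p + 7 * p * q + 2 * q * q) ≡ p * p + 9 * p * q + 8 * q * q
  e₂ = solve-∀

-- Doubling the density lowers the logarithm by 1, so `p / q - 1` is an upper estimate for the
-- denser list. The factor `2 ^ q` stays on the left because `p` may still be smaller than `q`.
density-doubles : ∀ {N R f a} p q → 1 ≤ R → 1 ≤ a → 2 * R * f ≤ a * N →
  N ^ q < 2 ^ p * R ^ q → 2 ^ q * f ^ q < 2 ^ p * a ^ q
density-doubles {N} {R} {f} {a} p q 1≤R 1≤a dbl h = *-cancelˡ-< (R ^ q) _ _ (begin-strict
  R ^ q * (2 ^ q * f ^ q)   ≡⟨ e₁ (R ^ q) (2 ^ q) (f ^ q) ⟩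
  2 ^ q * R ^ q * f ^ q     ≡⟨ cong (_* f ^ q) (sym (*-^-distrib 2 R q)) ⟩
  (2 * R) ^ q * f ^ q       ≡⟨ sym (*-^-distrib (2 * R) f q) ⟩
  (2 * R * f) ^ q           ≤⟨ ^-monoˡ-≤ q dbl ⟩
  (a * N) ^ q               ≡⟨ *-^-distrib a N q ⟩
  a ^ q * N ^ q             <⟨ *-monoʳ-< (a ^ q) {{m^n≢0 a q {{>-nonZero 1≤a}}}} h ⟩
  a ^ q * (2 ^ p * R ^ q)   ≡⟨ e₂ (a ^ q) (2 ^ p) (R ^ q) ⟩
  R ^ q * (2 ^ p * a ^ q)   ∎)
  where
  open ≤-Reasoning
  e₁ : ∀ x y z → x * (y * z) ≡ y * x * z
  e₁ = solve-∀
  e₂ : ∀ x y z → x * (y * z) ≡ z * (y * x)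
  e₂ = solve-∀

-- One doubling step: passing from L = p/q to L − 1 pays for L + 4 bags.
logBound-step : ∀ {N R j f a KF K} → Depth N R j → 1 ≤ R → 1 ≤ a → a ≤ f → 2 * R * f ≤ a * N →
  LogBound f a KF → K ≤ 3 + j + KF → LogBound N R K
logBound-step {N} {R} {j} {f} {a} {KF} {K} dep 1≤R 1≤a a≤f dbl bF K≤ p q 1≤q h with q ≤? p
-- Here `p / q < 1`, so the logarithm of `f / a` would be negative, against `a ≤ f`.
... | no q≰p = ⊥-elim (<-irrefl refl (begin-strict
  2 ^ q * f ^ q  <⟨ density-doubles {N} {R} {f} {a} p q 1≤R 1≤a dbl h ⟩
  2 ^ p * a ^ q  ≤⟨ *-mono-≤ (^-monoʳ-≤ 2 (<⇒≤ (≰⇒> q≰p))) (^-monoˡ-≤ q a≤f) ⟩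
  2 ^ q * f ^ q  ∎))
  where open ≤-Reasoning
... | yes q≤p with m≤n⇒∃[o]m+o≡n q≤p
... | r , refl = begin
  2 * K * (q * q)                                          ≤⟨ *-monoˡ-≤ (q * q) (*-monoʳ-≤ 2 K≤) ⟩
  2 * (3 + j + KF) * (q * q)                               ≡⟨ e₁ j KF q ⟩
  6 * (q * q) + 2 * q * (j * q) + 2 * KF * (q * q)
      ≤⟨ +-mono-≤ (+-monoʳ-≤ (6 * (q * q)) (*-monoʳ-≤ (2 * q) (depth-bound {N} {R} {j} (q + r) q dep h))) rec ⟩
  -- Nothing is lost here: `L² + 9 L + 8` drops by exactly `2 L + 8` when `L` drops by 1.
  6 * (q * q) + 2 * q * (q + r + q) + (r * r + 9 * r * q + 8 * q * q)  ≡⟨ e₂ r q ⟩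
  (q + r) * (q + r) + 9 * (q + r) * q + 8 * q * q          ∎
  where
  open ≤-Reasoning
  rec : 2 * KF * (q * q) ≤ r * r + 9 * r * q + 8 * q * q
  rec = bF r q 1≤q (*-cancelˡ-< (2 ^ q) _ _ (subst (2 ^ q * f ^ q <_)
          (trans (cong (_* a ^ q) (^-distribˡ-+-* 2 q r)) (*-assoc (2 ^ q) (2 ^ r) (a ^ q)))
          (density-doubles {N} {R} {f} {a} (q + r) q 1≤R 1≤a dbl h)))
  e₁ : ∀ j k q → 2 * (3 + j + k) * (q * q) ≡ 6 * (q * q) + 2 * q * (j * q) + 2 * k * (q * q)
  e₁ = solve-∀
  e₂ : ∀ r q → 6 * (q * q) + 2 * q * (q + r + q) + (r * r + 9 * r * q + 8 * q * q)
             ≡ (q + r) * (q + r) + 9 * (q + r) * q + 8 * q * q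
  e₂ = solve-∀

n≤2^n : ∀ n → n ≤ 2 ^ n
n≤2^n zero = z≤n
n≤2^n (suc n) = subst (suc n ≤_) (cong (2 ^ n +_) (sym (+-identityʳ (2 ^ n))))
                  (+-mono-≤ (m^n>0 2 n) (n≤2^n n))

-- A downward search from an exponent `i` that works. The failing exponent at which it stops is kept
-- as the witness of minimality.
least-doubling : ∀ J f i → J ≤ 2 ^ i * f → ∃ λ j → J ≤ 2 ^ j * f × (j ≡ 0 ⊎ ∃ λ i → j ≡ suc i × 2 ^ i * f < J)
least-doubling J f zero le = 0 , le , inj₁ refl
least-doubling J f (suc i) le with J ≤? 2 ^ i * f
... | yes le′ = least-doubling J f i le′
... | no ¬le = suc i , le , inj₂ (i , refl , ≰⇒> ¬le)

-- Minimality gives `2 ^ i * f < J`. Multiplying by `R` and comparing with `R * J ≤ f * N`, the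
-- factor `f` cancels and `Depth` remains. For `f = 0` there is nothing to cancel, but then `J = 0`.
find-depth : ∀ {N R} J f → 1 ≤ R → R * J ≤ f * N → ∃ λ j → J ≤ 2 ^ j * f × Depth N R j
find-depth {N} {R} J zero 1≤R le = 0 , J≤0 , inj₁ refl
  where
  J≤0 : J ≤ 0
  J≤0 = *-cancelˡ-≤ R {{>-nonZero 1≤R}} (subst (R * J ≤_) (sym (*-zeroʳ R)) le)
find-depth {N} {R} J f@(suc _) 1≤R le
  with least-doubling J f J (≤-trans (n≤2^n J) (m≤m*n (2 ^ J) f))
... | j , J≤ , inj₁ refl = j , J≤ , inj₁ refl
... | j , J≤ , inj₂ (i , refl , lt) = j , J≤ , inj₂ (i , refl , *-cancelˡ-< f _ _ (begin-strict
  f * (2 ^ i * R)  ≡⟨ e f (2 ^ i) R ⟩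
  R * (2 ^ i * f)  <⟨ *-monoʳ-< R {{>-nonZero 1≤R}} lt ⟩
  R * J            ≤⟨ le ⟩
  f * N            ∎))
  where
  open ≤-Reasoning
  e : ∀ x y z → x * (y * z) ≡ z * (y * x)
  e = solve-∀

-- Lists

_∈ₗ?_ : ∀ {n} (x : Fin n) (xs : List (Fin n)) → Dec (x ∈ₗ xs)
x ∈ₗ? xs = Any.any? (x ≟_) xs

split-list : ∀ {A : Set} z (xs : List A) → z ≤ length xs → ∃₂ λ ys zs → xs ≡ ys ++ zs × length ys ≡ z
split-list zero xs _ = [] , xs , refl , refl
split-list (suc z) (x ∷ xs) (s≤s le) with split-list z xs le
... | ys , zs , refl , eq = x ∷ ys , zs , refl , cong suc eq

last-of : ∀ {A : Set} (x : A) xs → ∃ λ l → ∃ λ init → x ∷ xs ≡ init ++ l ∷ []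
last-of x [] = x , [] , refl
last-of x (y ∷ ys) with last-of y ys
... | l , init , eq = l , x ∷ init , cong (x ∷_) eq

⊆-split : ∀ {A : Set} {zs : List A} xs {ys} → zs ⊆ xs ++ ys →
  ∃₂ λ zs₁ zs₂ → zs ≡ zs₁ ++ zs₂ × zs₁ ⊆ xs × zs₂ ⊆ ys
⊆-split [] s = [] , _ , refl , [] , s
⊆-split (x ∷ xs) (.x ∷ʳ s) with ⊆-split xs s
... | zs₁ , zs₂ , eq , s₁ , s₂ = zs₁ , zs₂ , eq , x ∷ʳ s₁ , s₂
⊆-split (x ∷ xs) (refl ∷ s) with ⊆-split xs s
... | zs₁ , zs₂ , refl , s₁ , s₂ = x ∷ zs₁ , zs₂ , refl , refl ∷ s₁ , s₂

unique-↭ : ∀ {A : Set} {xs ys : List A} → xs ↭ ys → Unique xs → Unique ys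
unique-↭ {A} p = Permₛ.Unique-resp-↭ (setoid A) (↭⇒↭ₛ p)

unique-++⁻ : ∀ {A : Set} xs {ys : List A} → Unique (xs ++ ys) → Unique xs × Unique ys × (∀ {v} → v ∈ₗ xs → v ∉ₗ ys)
unique-++⁻ [] u = [] , u , λ ()
unique-++⁻ (x ∷ xs) (px ∷ u) with unique-++⁻ xs u
... | ux , uy , disj = Allₚ.++⁻ˡ xs px ∷ ux , uy ,
  λ { (here refl) v∈ → All.lookup (Allₚ.++⁻ʳ xs px) v∈ refl ; (there p) → disj p }

unique-length : ∀ {A : Set} {xs ys : List A} → Unique xs → (∀ {x} → x ∈ₗ xs → x ∈ₗ ys) → length xs ≤ length ys
unique-length {xs = []} _ _ = z≤n
unique-length {xs = x ∷ xs} {ys} (x∉ ∷ u) sub with ∈-∃++ (sub (here refl))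
... | as , bs , refl = subst (suc (length xs) ≤_) (sym len) (s≤s (unique-length u rest))
  where
  len : length (as ++ x ∷ bs) ≡ suc (length (as ++ bs))
  len = trans (length-++ as) (trans (+-suc (length as) (length bs)) (cong suc (sym (length-++ as))))
  rest : ∀ {y} → y ∈ₗ xs → y ∈ₗ as ++ bs
  rest y∈ with ∈-++⁻ as (sub (there y∈))
  ... | inj₁ p = ∈-++⁺ˡ p
  ... | inj₂ (here refl) = ⊥-elim (All.lookup x∉ y∈ refl)
  ... | inj₂ (there p) = ∈-++⁺ʳ as p

filter-filter : ∀ {A : Set} {P Q : A → Set} (P? : Decidable P) (Q? : Decidable Q) (xs : List A) →
  filter Q? (filter P? xs) ≡ filter (λ v → P? v ×-dec Q? v) xs
filter-filter P? Q? [] = refl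
filter-filter P? Q? (x ∷ xs) with P? x
... | no _ = filter-filter P? Q? xs
... | yes _ with Q? x
... | yes _ = cong (x ∷_) (filter-filter P? Q? xs)
... | no _ = filter-filter P? Q? xs

-- Covers by bags, approximate cuts, and blocks on a circle.

module Cutting {n k : ℕ} (G : Graph n) (X : Fin k → Subset n) where

  open CommutativeMonoidSolver (++-commutativeMonoid {A = Fin n}) using (solve; _⊜_; _⊕_)

  Touch : Fin k → Fin n → Fin n → Set
  Touch c u v = u ∈ X c ⊎ v ∈ X c

  Touch-swap : ∀ {c u v} → Touch c u v → Touch c v u
  Touch-swap = Sum.swap

  Edge-sym : ∀ {u v} → Edge G u v → Edge G v u
  Edge-sym {u} {v} e rewrite Graph.sym G u v = e

  Covers : List (Fin k) → List (Fin n) → List (Fin n) → Set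
  Covers cs xs ys = ∀ {u v} → u ∈ₗ xs → v ∈ₗ ys → Edge G u v → Any (λ c → Touch c u v) cs

  covers-sym : ∀ {cs xs ys} → Covers cs xs ys → Covers cs ys xs
  covers-sym cov u∈ v∈ e = Any.map Touch-swap (cov v∈ u∈ (Edge-sym e))

  covers-++ˡ : ∀ {cs} xs {ys zs} → Covers cs xs zs → Covers cs ys zs → Covers cs (xs ++ ys) zs
  covers-++ˡ xs l r u∈ v∈ e with ∈-++⁻ xs u∈
  ... | inj₁ p = l p v∈ e
  ... | inj₂ p = r p v∈ e

  covers-++ʳ : ∀ {cs} {xs} ys {zs} → Covers cs xs ys → Covers cs xs zs → Covers cs xs (ys ++ zs)
  covers-++ʳ ys l r u∈ v∈ e with ∈-++⁻ ys v∈
  ... | inj₁ p = l u∈ p e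
  ... | inj₂ p = r u∈ p e

  -- `C` aims at size `w` and may miss it by `w / 2 ^ j`; `near` states this with the denominator
  -- cleared. Its alternative `D ≡ []` is the case in which `U` is used up first.
  record Approx (U : List (Fin n)) (w j : ℕ) : Set where
    field
      {C D}  : List (Fin n)
      {bags} : List (Fin k)
      perm   : C ++ D ↭ U
      covers : Covers bags C D
      few    : length bags ≤ j
      small  : length C ≤ w
      near   : D ≡ [] ⊎ 2 ^ j * w ≤ 2 ^ j * length C + w

  -- Turns the error of a cut into a number of vertices: what `C` lacks can be made up by `f`
  -- vertices available elsewhere.
  approx-near : ∀ {U w j} (A : Approx U w j) f → w ≤ 2 ^ j * f → w ≤ length U + f → w ≤ length (Approx.C A) + f
  approx-near {U} {w} {j} A f w≤ w≤U with Approx.near A | Approx.perm A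
  ... | inj₁ refl | p = subst (λ x → w ≤ x + f)
          (trans (sym (↭-length p)) (cong length (++-identityʳ (Approx.C A)))) w≤U
  ... | inj₂ le   | _ = *-cancelˡ-≤ (2 ^ j) {{m^n≢0 2 j}} (≤-trans le
          (subst (2 ^ j * length (Approx.C A) + w ≤_) (sym (*-distribˡ-+ (2 ^ j) (length (Approx.C A)) f))
            (+-monoʳ-≤ (2 ^ j * length (Approx.C A)) w≤)))

  -- `hub` is a node of the path and `hang` holds the vertices of the subtrees attached there.
  -- `cut-hang` spares `own`, for the case that the block being cut also supplies the single
  -- vertices correcting the size.
  record Block : Set where
    field
      hub      : Fin k
      own hang : List (Fin n)
      own⊆hub  : ∀ {v} → v ∈ₗ own → v ∈ X hub
      cut      : ∀ w j → Approx (own ++ hang) w j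
      cut-hang : ∀ w j → Approx hang w j
  open Block

  els : Block → List (Fin n)
  els b = own b ++ hang b

  flatten : List Block → List (Fin n)
  flatten [] = []
  flatten (b ∷ bs) = els b ++ flatten bs

  size : Block → ℕ
  size b = length (els b)

  tot ow : List Block → ℕ
  tot [] = 0
  tot (b ∷ bs) = size b + tot bs
  ow [] = 0
  ow (b ∷ bs) = length (own b) + ow bs

  length-flatten : ∀ bs → length (flatten bs) ≡ tot bs
  length-flatten [] = refl
  length-flatten (b ∷ bs) = trans (length-++ (els b)) (cong (size b +_) (length-flatten bs))

  flatten-++ : ∀ xs ys → flatten (xs ++ ys) ≡ flatten xs ++ flatten ys
  flatten-++ [] ys = refl
  flatten-++ (x ∷ xs) ys = trans (cong (els x ++_) (flatten-++ xs ys)) (sym (++-assoc (els x) _ _))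

  tot-++ : ∀ xs ys → tot (xs ++ ys) ≡ tot xs + tot ys
  tot-++ [] ys = refl
  tot-++ (x ∷ xs) ys = trans (cong (size x +_) (tot-++ xs ys)) (sym (+-assoc (size x) _ _))

  ow-++ : ∀ xs ys → ow (xs ++ ys) ≡ ow xs + ow ys
  ow-++ [] ys = refl
  ow-++ (x ∷ xs) ys = trans (cong (length (own x) +_) (ow-++ xs ys)) (sym (+-assoc (length (own x)) _ _))

  own≤size : ∀ b → length (own b) ≤ size b
  own≤size b = subst (length (own b) ≤_) (sym (length-++ (own b))) (m≤m+n _ _)

  ow≤tot : ∀ bs → ow bs ≤ tot bs
  ow≤tot [] = z≤n
  ow≤tot (b ∷ bs) = +-mono-≤ (own≤size b) (ow≤tot bs)

  ∈-flatten⁻ : ∀ {v} bs → v ∈ₗ flatten bs → ∃ λ b → b ∈ₗ bs × v ∈ₗ els b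
  ∈-flatten⁻ (b ∷ bs) v∈ with ∈-++⁻ (els b) v∈
  ... | inj₁ p = b , here refl , p
  ... | inj₂ p with ∈-flatten⁻ bs p
  ... | b′ , q , r = b′ , there q , r

  Adjacent : Block → Block → Set
  Adjacent x y = ∀ {u v} → u ∈ₗ els x → v ∈ₗ els y → Edge G u v → Touch (hub x) u v × Touch (hub y) u v

  -- On a line the hub in between would do. After a rotation the separating block may lie on either
  -- of the two arcs between `x` and `y`, hence the disjunction.
  Separated : (x y s s′ : Block) → Set
  Separated x y s s′ = ∀ {u v} → u ∈ₗ els x → v ∈ₗ els y → Edge G u v → Touch (hub s) u v ⊎ Touch (hub s′) u v

  -- The cyclic order a, b, c, d: each of the two crossing pairs separates the other.
  Crossing : (a b c d : Block) → Set
  Crossing a b c d = Separated b d a c × Separated a c b d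

  record Cyclic (L : List Block) : Set where
    field
      pairs     : ∀ {a b} → (a ∷ b ∷ []) ⊆ L → Adjacent a b
      quadruple : ∀ {a b c d} → (a ∷ b ∷ c ∷ d ∷ []) ⊆ L → Crossing a b c d
  open Cyclic

  adjacent-sym : ∀ x y → Adjacent x y → Adjacent y x
  adjacent-sym x y adj u∈ v∈ e with adj v∈ u∈ (Edge-sym e)
  ... | p , q = Touch-swap q , Touch-swap p

  crossing-rotate : ∀ a b c d → Crossing b c d a → Crossing a b c d
  crossing-rotate a b c d (p , q) =
    (λ u∈ v∈ e → Sum.swap (q u∈ v∈ e)) ,
    (λ u∈ v∈ e → Sum.map Touch-swap Touch-swap (p v∈ u∈ (Edge-sym e)))

  cyclic-⊆ : ∀ {K L} → K ⊆ L → Cyclic L → Cyclic K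
  cyclic-⊆ s c = record { pairs = λ t → pairs c (⊆-trans t s) ; quadruple = λ t → quadruple c (⊆-trans t s) }

  -- A sublist is split at the seam and its two pieces are exchanged, which gives a sublist of the
  -- original order. Each block carried across the seam is undone by one `crossing-rotate`.
  cyclic-rotate : ∀ xs {ys} → Cyclic (xs ++ ys) → Cyclic (ys ++ xs)
  cyclic-rotate xs {ys} cyc = record { pairs = two ; quadruple = four }
    where
    two : ∀ {a b} → (a ∷ b ∷ []) ⊆ ys ++ xs → Adjacent a b
    two {a} {b} s with ⊆-split ys s
    ... | [] , _ , refl , s₁ , s₂ = pairs cyc (⊆-++⁺ s₂ s₁)
    ... | _ ∷ [] , _ , refl , s₁ , s₂ = adjacent-sym b a (pairs cyc (⊆-++⁺ s₂ s₁))
    ... | _ ∷ _ ∷ [] , [] , refl , s₁ , s₂ = pairs cyc (⊆-++⁺ s₂ s₁)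
    four : ∀ {a b c d} → (a ∷ b ∷ c ∷ d ∷ []) ⊆ ys ++ xs → Crossing a b c d
    four {a} {b} {c} {d} s with ⊆-split ys s
    ... | [] , _ , refl , s₁ , s₂ = quadruple cyc (⊆-++⁺ s₂ s₁)
    ... | _ ∷ [] , _ , refl , s₁ , s₂ = crossing-rotate a b c d (quadruple cyc (⊆-++⁺ s₂ s₁))
    ... | _ ∷ _ ∷ [] , _ , refl , s₁ , s₂ =
      crossing-rotate a b c d (crossing-rotate b c d a (quadruple cyc (⊆-++⁺ s₂ s₁)))
    ... | _ ∷ _ ∷ _ ∷ [] , _ , refl , s₁ , s₂ =
      crossing-rotate a b c d (crossing-rotate b c d a (crossing-rotate c d a b (quadruple cyc (⊆-++⁺ s₂ s₁))))
    ... | _ ∷ _ ∷ _ ∷ _ ∷ [] , [] , refl , s₁ , s₂ = quadruple cyc (⊆-++⁺ s₂ s₁)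

  record Solution (L : List Block) (m : ℕ) : Set where
    field
      {B W}  : List (Fin n)
      {bags} : List (Fin k)
      perm   : B ++ W ↭ flatten L
      sizeB  : length B ≡ m
      covers : Covers bags B W
      bound  : LogBound (tot L) (ow L) (length bags)

  solution-length : ∀ {L m} (S : Solution L m) → m + length (Solution.W S) ≡ tot L
  solution-length {L} S = trans (cong (_+ length W) (sym sizeB))
    (trans (sym (length-++ B)) (trans (↭-length perm) (length-flatten L)))
    where open Solution S

  -- Each round of the walk passes to the complementary arc; this translates its solution back.
  solution-swap : ∀ {L m m′} → m + m′ ≡ tot L → Solution L m → Solution L m′
  solution-swap {L} {m} {m′} eq S = record
    { perm   = ↭-trans (++-comm W B) perm
    ; sizeB  = +-cancelˡ-≡ m _ _ (trans (solution-length S) (sym eq))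
    ; covers = covers-sym {bags} {B} {W} covers
    ; bound  = bound }
    where open Solution S

  solution-rotate : ∀ xs ys {m} → Solution (xs ++ ys) m → Solution (ys ++ xs) m
  solution-rotate xs ys S = record
    { perm   = ↭-trans perm (↭-trans (↭-reflexive (flatten-++ xs ys))
                 (↭-trans (++-comm (flatten xs) _) (↭-reflexive (sym (flatten-++ ys xs)))))
    ; sizeB  = sizeB
    ; covers = covers
    ; bound  = subst₂ (λ N R → LogBound N R (length bags))
        (trans (tot-++ xs ys) (trans (+-comm (tot xs) _) (sym (tot-++ ys xs))))
        (trans (ow-++ xs ys) (trans (+-comm (ow xs) _) (sym (ow-++ ys xs)))) bound }
    where open Solution S

  -- Explicit cuts that end the walk.

  module _ {t L} (cyc : Cyclic (t ∷ L)) where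

    head-covers : ∀ {u v} → u ∈ₗ els t → v ∈ₗ flatten L → Edge G u v → Touch (hub t) u v
    head-covers u∈ v∈ e with ∈-flatten⁻ L v∈
    ... | y , y∈ , v∈y = proj₁ (pairs cyc (refl ∷ from∈ y∈) u∈ v∈y e)

    around-covers : ∀ {xs s ys} → L ≡ xs ++ s ∷ ys → ∀ {u v} → u ∈ₗ flatten xs → v ∈ₗ flatten ys →
      Edge G u v → Touch (hub t) u v ⊎ Touch (hub s) u v
    around-covers {xs} {s} {ys} refl u∈ v∈ e with ∈-flatten⁻ xs u∈ | ∈-flatten⁻ ys v∈
    ... | x , x∈ , u∈x | y , y∈ , v∈y =
      proj₁ (quadruple cyc (refl ∷ ⊆-++⁺ (from∈ x∈) (refl ∷ from∈ y∈))) u∈x v∈y e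

    before-covers : ∀ {xs s ys} → L ≡ xs ++ s ∷ ys → ∀ {u v} → u ∈ₗ flatten xs → v ∈ₗ els s →
      Edge G u v → Touch (hub s) u v
    before-covers {xs} {s} {ys} refl u∈ v∈ e with ∈-flatten⁻ xs u∈
    ... | x , x∈ , u∈x = proj₂ (pairs cyc (t ∷ʳ ⊆-++⁺ (from∈ x∈) (refl ∷ minimum ys)) u∈x v∈ e)

    after-covers : ∀ {xs s ys} → L ≡ xs ++ s ∷ ys → ∀ {u v} → u ∈ₗ els s → v ∈ₗ flatten ys →
      Edge G u v → Touch (hub s) u v
    after-covers {xs} {s} {ys} refl u∈ v∈ e with ∈-flatten⁻ ys v∈
    ... | y , y∈ , v∈y = proj₁ (pairs cyc (t ∷ʳ ⊆-++⁺ˡ xs (refl ∷ from∈ y∈)) u∈ v∈y e)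

  -- The last block of t ∷ mid reaches M vertices beyond μ; remove M vertices, z of them from own t.
  finish-self : ∀ t post {μ M} → Cyclic (t ∷ post) → size t ≡ μ + M → 1 ≤ ow (t ∷ post) →
    ow (t ∷ post) * M ≤ length (own t) * tot (t ∷ post) → Solution (t ∷ post) μ
  finish-self t post {μ} {M} cyc len 1≤R dense
    with find-depth {tot (t ∷ post)} M (length (own t)) 1≤R dense
  ... | j , M≤ , dep
    with m≤n⇒∃[o]m+o≡n (Approx.small (cut-hang t M j))
  ... | z , eqM
    with split-list z (own t) (+-cancelˡ-≤ (length (Approx.C (cut-hang t M j))) _ _
           (subst (_≤ length (Approx.C (cut-hang t M j)) + length (own t)) (sym eqM)
               (approx-near (cut-hang t M j) (length (own t)) M≤
             (subst (M ≤_) (trans (sym len) (trans (length-++ (own t)) (+-comm (length (own t)) _))) (m≤n+m M μ)))))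
  ... | o₁ , o₂ , eqo , refl = record
    { B      = o₂ ++ D
    ; W      = o₁ ++ C ++ flatten post
    ; bags   = hub t ∷ bags
    ; perm   = ↭-trans (solve 5 (λ b d a c p → (b ⊕ d) ⊕ (a ⊕ (c ⊕ p)) ⊜ ((a ⊕ b) ⊕ (c ⊕ d)) ⊕ p)
          ↭-refl o₂ D o₁ C (flatten post))
                 (++⁺ (++⁺ (↭-reflexive (sym eqo)) perm) ↭-refl)
    ; sizeB  = trans (length-++ o₂) (+-cancelʳ-≡ M _ _ (trans lens len))
    ; covers = covers-++ˡ o₂ (λ u∈ v∈ e → here (inj₁ (own⊆hub t (o₂⊆ u∈))))
        (covers-++ʳ o₁ (λ u∈ v∈ e → here (inj₂ (own⊆hub t (o₁⊆ v∈))))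
          (covers-++ʳ C (λ u∈ v∈ e → there (covers-sym {bags} {C} {D} covers u∈ v∈ e))
            (λ u∈ v∈ e → here (head-covers cyc (∈-++⁺ʳ (own t) (D⊆ u∈)) v∈ e))))
    ; bound  = logBound-direct {j = j} dep (s≤s (≤-trans few (n≤1+n j))) }
    where
    open Approx (cut-hang t M j)
    o₁⊆ : ∀ {v} → v ∈ₗ o₁ → v ∈ₗ own t
    o₁⊆ p = subst (_ ∈ₗ_) (sym eqo) (∈-++⁺ˡ p)
    o₂⊆ : ∀ {v} → v ∈ₗ o₂ → v ∈ₗ own t
    o₂⊆ p = subst (_ ∈ₗ_) (sym eqo) (∈-++⁺ʳ o₁ p)
    D⊆ : ∀ {v} → v ∈ₗ D → v ∈ₗ hang t
    D⊆ p = ∈-resp-↭ perm (∈-++⁺ʳ C p)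
    lens : length o₂ + length D + M ≡ size t
    lens = begin
      length o₂ + length D + M                       ≡⟨ cong (length o₂ + length D +_) (sym eqM) ⟩
      length o₂ + length D + (length C + length o₁)  ≡⟨ e (length o₂) (length D) (length C) (length o₁) ⟩
      (length o₁ + length o₂) + (length C + length D)
          ≡⟨ cong₂ _+_ (trans (sym (length-++ o₁)) (cong length (sym eqo))) (trans (sym (length-++ C)) (↭-length perm)) ⟩
      length (own t) + length (hang t)               ≡⟨ sym (length-++ (own t)) ⟩
      size t                                         ∎
      where
      open ≡-Reasoning
      e : ∀ a b c d → a + b + (c + d) ≡ (d + a) + (c + b)
      e = solve-∀

  -- `B` is an arc from inside `own t` to inside `b`. The cut takes `C` off `b`, and the missing
  -- `M - length C` vertices come from `own t`, which `dense` makes large enough for the error. The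
  -- two hubs and the `j` bags of the cut cover all crossing edges.
  finish-other : ∀ t mid b post {μ M} → Cyclic (t ∷ mid ++ b ∷ post) → size t + (tot mid + size b) ≡ μ + M → M ≤ size b →
    1 ≤ ow (t ∷ mid ++ b ∷ post) →
    ow (t ∷ mid ++ b ∷ post) * M ≤ length (own t) * tot (t ∷ mid ++ b ∷ post) → Solution (t ∷ mid ++ b ∷ post) μ
  finish-other t mid b post {μ} {M} cyc len M≤b 1≤R dense
    with find-depth {tot (t ∷ mid ++ b ∷ post)} M (length (own t)) 1≤R dense
  ... | j , M≤ , dep
    with m≤n⇒∃[o]m+o≡n (Approx.small (cut b M j))
  ... | z , eqM
    with split-list z (own t) (+-cancelˡ-≤ (length (Approx.C (cut b M j))) _ _
           (subst (_≤ length (Approx.C (cut b M j)) + length (own t)) (sym eqM)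
               (approx-near (cut b M j) (length (own t)) M≤ (≤-trans M≤b (m≤m+n _ _)))))
  ... | o₁ , o₂ , eqo , refl = record
    { B      = (o₂ ++ hang t) ++ flatten mid ++ D
    ; W      = o₁ ++ C ++ flatten post
    ; bags   = hub t ∷ hub b ∷ bags
    ; perm   = ↭-trans (solve 7 (λ o₁ o₂ h m C D p → ((o₂ ⊕ h) ⊕ (m ⊕ D)) ⊕ (o₁ ⊕ (C ⊕ p)) ⊜ ((o₁ ⊕ o₂) ⊕ h) ⊕ (m ⊕ ((C ⊕ D) ⊕ p)))
          ↭-refl o₁ o₂ (hang t) (flatten mid) C D (flatten post))
                 (++⁺ (++⁺ (↭-reflexive (sym eqo)) ↭-refl)
                   (↭-trans (++⁺ (↭-refl {x = flatten mid}) (++⁺ perm ↭-refl))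
                       (↭-reflexive (sym (flatten-++ mid (b ∷ post))))))
    ; sizeB  = trans (trans (length-++ (o₂ ++ hang t))
          (cong₂ _+_ (length-++ o₂) (trans (length-++ (flatten mid)) (cong (_+ length D) (length-flatten mid)))))
                 (+-cancelʳ-≡ M _ _ (trans lens len))
    ; covers = covers-++ˡ (o₂ ++ hang t)
        (covers-++ʳ o₁ (λ u∈ v∈ e → here (inj₂ (own⊆hub t (o₁⊆ v∈))))
          (λ u∈ v∈ e → here (head-covers cyc (t⊆ u∈) (later⊆ v∈) e)))
        (covers-++ˡ (flatten mid)
          (covers-++ʳ o₁ (λ u∈ v∈ e → here (inj₂ (own⊆hub t (o₁⊆ v∈))))
            (covers-++ʳ C (λ u∈ v∈ e → there (here (before-covers cyc refl u∈ (C⊆ v∈) e)))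
              (λ u∈ v∈ e → two (around-covers cyc refl u∈ v∈ e))))
          (covers-++ʳ o₁ (λ u∈ v∈ e → here (inj₂ (own⊆hub t (o₁⊆ v∈))))
            (covers-++ʳ C (λ u∈ v∈ e → there (there (covers-sym {bags} {C} {D} covers u∈ v∈ e)))
              (λ u∈ v∈ e → there (here (after-covers cyc {mid} refl (D⊆ u∈) v∈ e))))))
    ; bound  = logBound-direct {j = j} dep (s≤s (s≤s few)) }
    where
    open Approx (cut b M j)
    two : ∀ {u v} → Touch (hub t) u v ⊎ Touch (hub b) u v → Any (λ c → Touch c u v) (hub t ∷ hub b ∷ bags)
    two (inj₁ p) = here p
    two (inj₂ p) = there (here p)
    o₁⊆ : ∀ {v} → v ∈ₗ o₁ → v ∈ₗ own t
    o₁⊆ p = subst (_ ∈ₗ_) (sym eqo) (∈-++⁺ˡ p)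
    t⊆ : ∀ {v} → v ∈ₗ o₂ ++ hang t → v ∈ₗ els t
    t⊆ p with ∈-++⁻ o₂ p
    ... | inj₁ q = ∈-++⁺ˡ (subst (_ ∈ₗ_) (sym eqo) (∈-++⁺ʳ o₁ q))
    ... | inj₂ q = ∈-++⁺ʳ (own t) q
    C⊆ : ∀ {v} → v ∈ₗ C → v ∈ₗ els b
    C⊆ p = ∈-resp-↭ perm (∈-++⁺ˡ p)
    D⊆ : ∀ {v} → v ∈ₗ D → v ∈ₗ els b
    D⊆ p = ∈-resp-↭ perm (∈-++⁺ʳ C p)
    later⊆ : ∀ {v} → v ∈ₗ C ++ flatten post → v ∈ₗ flatten (mid ++ b ∷ post)
    later⊆ p = subst (_ ∈ₗ_) (sym (flatten-++ mid (b ∷ post))) (∈-++⁺ʳ (flatten mid) (later (∈-++⁻ C p)))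
      where
      later : ∀ {v} → v ∈ₗ C ⊎ v ∈ₗ flatten post → v ∈ₗ els b ++ flatten post
      later (inj₁ q) = ∈-++⁺ˡ (C⊆ q)
      later (inj₂ q) = ∈-++⁺ʳ (els b) q
    lens : length o₂ + length (hang t) + (tot mid + length D) + M ≡ size t + (tot mid + size b)
    lens = begin
      length o₂ + length (hang t) + (tot mid + length D) + M
          ≡⟨ cong (length o₂ + length (hang t) + (tot mid + length D) +_) (sym eqM) ⟩
      length o₂ + length (hang t) + (tot mid + length D) + (length C + length o₁)
          ≡⟨ e (length o₂) (length (hang t)) (tot mid) (length D) (length C) (length o₁) ⟩
      (length o₁ + length o₂) + length (hang t) + (tot mid + (length C + length D))
          ≡⟨ cong₂ (λ x y → x + length (hang t) + (tot mid + y)) (trans (sym (length-++ o₁)) (cong length (sym eqo))) (trans (sym (length-++ C)) (↭-length perm)) ⟩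
      length (own t) + length (hang t) + (tot mid + size b)
          ≡⟨ cong (_+ (tot mid + size b)) (sym (length-++ (own t))) ⟩
      size t + (tot mid + size b)                                         ∎
      where
      open ≡-Reasoning
      e : ∀ a b c d e f → a + b + (c + d) + (e + f) ≡ (f + a) + b + (c + (e + d))
      e = solve-∀

  Recursive : List Block → Set
  Recursive F = ∀ m → m ≤ tot F → Solution F m

  -- The cut of `t` overshoots on purpose: aiming at `M + tot F` with error at most `tot F`, it
  -- removes `M + z` vertices with `z ≤ tot F`. The surplus `z` is put back by the recursive
  -- solution inside `F`. Apart from the bags of these two cuts, the hubs of `t` and of the first
  -- and last block of `F` suffice.
  finish-double : ∀ t Mid f₁ F′ Rest {μ M} → let F = f₁ ∷ F′ in let L = t ∷ Mid ++ F ++ Rest in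
    Cyclic L → Recursive F → size t + tot Mid ≡ μ + M → M + tot F ≤ size t →
    1 ≤ ow L → 1 ≤ ow F → 2 * ow L * tot F ≤ ow F * tot L → ow L * (M + tot F) ≤ tot F * tot L →
    Solution L μ
  finish-double t Mid f₁ F′ Rest {μ} {M} cyc rec len J≤t 1≤R 1≤a dbl fat
    with find-depth {tot (t ∷ Mid ++ (f₁ ∷ F′) ++ Rest)} (M + tot (f₁ ∷ F′)) (tot (f₁ ∷ F′)) 1≤R fat
  ... | j , J≤ , dep
    with m≤n⇒∃[o]m+o≡n (+-cancelʳ-≤ (tot (f₁ ∷ F′)) _ _
        (approx-near (cut t (M + tot (f₁ ∷ F′)) j) (tot (f₁ ∷ F′)) J≤ (≤-trans J≤t (m≤m+n _ _))))
  ... | z , eqC = record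
    { B      = D ++ flatten Mid ++ S.B
    ; W      = C ++ flatten Rest ++ S.W
    ; bags   = hub t ∷ hub f₁ ∷ hub (proj₁ last-F) ∷ bags ++ S.bags
    ; perm   = ↭-trans (solve 6 (λ D m B C r W → (D ⊕ (m ⊕ B)) ⊕ (C ⊕ (r ⊕ W)) ⊜ (C ⊕ D) ⊕ (m ⊕ ((B ⊕ W) ⊕ r)))
          ↭-refl D (flatten Mid) S.B C (flatten Rest) S.W)
                 (++⁺ perm (↭-trans (++⁺ (↭-refl {x = flatten Mid}) (++⁺ S.perm ↭-refl))
                   (↭-reflexive (sym (trans (flatten-++ Mid (F ++ Rest)) (cong (flatten Mid ++_) (flatten-++ F Rest)))))))
    ; sizeB  = trans (length-++ D)
          (trans (cong (length D +_) (trans (length-++ (flatten Mid)) (cong₂ _+_ (length-flatten Mid) S.sizeB)))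
                 (+-cancelʳ-≡ M _ _ (trans lens len)))
    ; covers = covers-++ˡ D
        (covers-++ʳ C (λ u∈ v∈ e → there (there (there (Anyₚ.++⁺ˡ (covers-sym {bags} {C} {D} covers u∈ v∈ e)))))
          (λ u∈ v∈ e → here (head-covers cyc (D⊆ u∈) (restW⊆ v∈) e)))
        (covers-++ˡ (flatten Mid)
          (covers-++ʳ C (λ u∈ v∈ e → here (Touch-swap (head-covers cyc (C⊆ v∈) (mid⊆ u∈) (Edge-sym e))))
            (covers-++ʳ (flatten Rest)
              (λ u∈ v∈ e → two (around-covers cyc refl u∈
                  (subst (_ ∈ₗ_) (sym (flatten-++ F′ Rest)) (∈-++⁺ʳ (flatten F′) v∈)) e))
              (λ u∈ v∈ e → mid-F u∈ (∈-++⁻ (els f₁) (∈-resp-↭ S.perm (∈-++⁺ʳ S.B v∈))) e)))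
          (covers-++ʳ C (λ u∈ v∈ e → here (Touch-swap (head-covers cyc (C⊆ v∈) (F⊆ (S∈ u∈)) (Edge-sym e))))
            (covers-++ʳ (flatten Rest)
              (λ u∈ v∈ e → F-rest (proj₂ last-F) (S∈ u∈) v∈ e)
              (λ u∈ v∈ e → there (there (there (Anyₚ.++⁺ʳ bags (S.covers u∈ v∈ e))))))))
    ; bound  = logBound-step {j = j} {f = tot F} {a = ow F} {KF = length S.bags} dep 1≤R 1≤a (ow≤tot F) dbl S.bound
        (s≤s (s≤s (s≤s (subst (_≤ j + length S.bags) (sym (length-++ bags)) (+-monoˡ-≤ (length S.bags) few))))) }
    where
    F = f₁ ∷ F′
    open Approx (cut t (M + tot F) j)
    module S = Solution (rec z (+-cancelˡ-≤ M _ _ (subst (_≤ M + tot F) (sym eqC) small)))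
    last-F : ∃ λ f → ∃ λ init → F ≡ init ++ f ∷ []
    last-F = last-of f₁ F′
    C⊆ : ∀ {v} → v ∈ₗ C → v ∈ₗ els t
    C⊆ p = ∈-resp-↭ perm (∈-++⁺ˡ p)
    D⊆ : ∀ {v} → v ∈ₗ D → v ∈ₗ els t
    D⊆ p = ∈-resp-↭ perm (∈-++⁺ʳ C p)
    S∈ : ∀ {v} → v ∈ₗ S.B → v ∈ₗ flatten F
    S∈ p = ∈-resp-↭ S.perm (∈-++⁺ˡ p)
    flat : flatten (Mid ++ F ++ Rest) ≡ flatten Mid ++ flatten F ++ flatten Rest
    flat = trans (flatten-++ Mid (F ++ Rest)) (cong (flatten Mid ++_) (flatten-++ F Rest))
    mid⊆ : ∀ {v} → v ∈ₗ flatten Mid → v ∈ₗ flatten (Mid ++ F ++ Rest)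
    mid⊆ p = subst (_ ∈ₗ_) (sym flat) (∈-++⁺ˡ p)
    F⊆ : ∀ {v} → v ∈ₗ flatten F → v ∈ₗ flatten (Mid ++ F ++ Rest)
    F⊆ p = subst (_ ∈ₗ_) (sym flat) (∈-++⁺ʳ (flatten Mid) (∈-++⁺ˡ p))
    restW⊆ : ∀ {v} → v ∈ₗ flatten Rest ++ S.W → v ∈ₗ flatten (Mid ++ F ++ Rest)
    restW⊆ p with ∈-++⁻ (flatten Rest) p
    ... | inj₁ q = subst (_ ∈ₗ_) (sym flat) (∈-++⁺ʳ (flatten Mid) (∈-++⁺ʳ (flatten F) q))
    ... | inj₂ q = F⊆ (∈-resp-↭ S.perm (∈-++⁺ʳ S.B q))
    two : ∀ {u v c d} {cs} → Touch c u v ⊎ Touch d u v → Any (λ c → Touch c u v) (c ∷ d ∷ cs)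
    two (inj₁ p) = here p
    two (inj₂ p) = there (here p)
    mid-F : ∀ {u v cs} → u ∈ₗ flatten Mid → v ∈ₗ els f₁ ⊎ v ∈ₗ flatten F′ → Edge G u v →
        Any (λ c → Touch c u v) (hub t ∷ hub f₁ ∷ cs)
    mid-F u∈ (inj₁ v∈) e = there (here (before-covers cyc refl u∈ v∈ e))
    mid-F u∈ (inj₂ v∈) e = two (around-covers cyc refl u∈ (subst (_ ∈ₗ_) (sym (flatten-++ F′ Rest)) (∈-++⁺ˡ v∈)) e)
    -- The last block `f` of `F` stands between the earlier blocks of `F` and `Rest`; edges from `f`
    -- itself touch its hub anyway.
    F-rest : ∀ {f c cs} → (∃ λ init → F ≡ init ++ f ∷ []) → ∀ {u v} → u ∈ₗ flatten F → v ∈ₗ flatten Rest → Edge G u v →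
      Any (λ c → Touch c u v) (hub t ∷ c ∷ hub f ∷ cs)
    F-rest {f} (init , eq) {u} {v} u∈ v∈ e =
        go (∈-++⁻ (flatten init) (subst (u ∈ₗ_) (trans (cong flatten eq) (flatten-++ init (f ∷ []))) u∈))
      where
      shape : Mid ++ F ++ Rest ≡ (Mid ++ init) ++ f ∷ Rest
      shape = trans (cong (λ F → Mid ++ F ++ Rest) eq)
          (trans (cong (Mid ++_) (++-assoc init (f ∷ []) Rest)) (sym (++-assoc Mid init (f ∷ Rest))))
      three : ∀ {c cs} → Touch (hub t) u v ⊎ Touch (hub f) u v → Any (λ c → Touch c u v) (hub t ∷ c ∷ hub f ∷ cs)
      three (inj₁ p) = here p
      three (inj₂ p) = there (there (here p))
      go : ∀ {c cs} → u ∈ₗ flatten init ⊎ u ∈ₗ els f ++ [] → Any (λ c → Touch c u v) (hub t ∷ c ∷ hub f ∷ cs)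
      go (inj₁ p) = three (around-covers cyc shape
          (subst (u ∈ₗ_) (sym (flatten-++ Mid init)) (∈-++⁺ʳ (flatten Mid) p)) v∈ e)
      go (inj₂ p) = there (there (here (after-covers cyc {Mid ++ init} shape
          (subst (u ∈ₗ_) (++-identityʳ (els f)) p) v∈ e)))
    lens : length D + (tot Mid + z) + M ≡ size t + tot Mid
    lens = begin
      length D + (tot Mid + z) + M    ≡⟨ e₁ (length D) (tot Mid) z M ⟩
      (M + z) + length D + tot Mid    ≡⟨ cong (λ x → x + length D + tot Mid) eqC ⟩
      length C + length D + tot Mid   ≡⟨ cong (_+ tot Mid) (trans (sym (length-++ C)) (↭-length perm)) ⟩
      size t + tot Mid                ∎
      where
      open ≡-Reasoning
      e₁ : ∀ d m z M → d + (m + z) + M ≡ (M + z) + d + m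
      e₁ = solve-∀

  -- The walk around a cyclic list of blocks

  -- Takes blocks greedily while they fit. The recorded overflow of the next block becomes the
  -- condition `longer` of the next state.
  scan : ∀ T J post → J ≤ T → ∃₂ λ F rest → post ≡ F ++ rest × J + tot F ≤ T ×
    (rest ≡ [] ⊎ ∃₂ λ b post′ → rest ≡ b ∷ post′ × T < J + tot F + size b)
  scan T J [] J≤T = [] , [] , refl , subst (_≤ T) (sym (+-identityʳ J)) J≤T , inj₁ refl
  scan T J (b ∷ post) J≤T with J + size b ≤? T
  ... | no ¬fit = [] , b ∷ post , refl , subst (_≤ T) (sym (+-identityʳ J)) J≤T ,
          inj₂ (b , post , refl , subst (T <_) (cong (_+ size b) (sym (+-identityʳ J))) (≰⇒> ¬fit))
  ... | yes fit with scan T (J + size b) post fit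
  ... | F , rest , refl , le , stop = b ∷ F , rest , refl , subst (_≤ T) assoc le ,
          Sum.map₂ (λ { (b′ , post′ , eq , lt) → b′ , post′ , eq , subst (λ x → T < x + size b′) assoc lt }) stop
    where
    assoc : J + size b + tot F ≡ J + (size b + tot F)
    assoc = +-assoc J (size b) (tot F)

  -- Finds the block in which position `m` falls, with `M` vertices of it beyond that position.
  -- Quantifying over all splittings `mid ++ b ∷ []` speaks of the last block without distinguishing
  -- whether it is `x` itself.
  locate : ∀ x xs m → m ≤ tot (x ∷ xs) → ∃ λ Mid → ∃ λ post → ∃ λ M → xs ≡ Mid ++ post × tot (x ∷ Mid) ≡ m + M ×
    (∀ mid b → x ∷ Mid ≡ mid ++ b ∷ [] → M ≤ size b)
  locate x xs m m≤ with m ≤? size x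
  ... | yes le with m≤n⇒∃[o]m+o≡n le
  ... | M , eq = [] , xs , M , refl , trans (+-identityʳ _) (sym eq) ,
          λ { [] b refl → subst (M ≤_) eq (m≤n+m M m) ; (_ ∷ []) b () ; (_ ∷ _ ∷ _) b () }
  locate x [] m m≤ | no ¬le = ⊥-elim (¬le (subst (m ≤_) (+-identityʳ _) m≤))
  locate x (y ∷ ys) m m≤ | no ¬le with m≤n⇒∃[o]m+o≡n (<⇒≤ (≰⇒> ¬le))
  ... | m′ , refl with locate y ys m′ (+-cancelˡ-≤ (size x) _ _ m≤)
  ... | Mid , post , M , refl , len , last = y ∷ Mid , post , M , refl ,
          trans (cong (size x +_) len) (sym (+-assoc (size x) m′ M)) ,
          λ { [] b () ; (_ ∷ mid) b eq → last mid b (∷-injectiveʳ eq) }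

  module _ (L₀ : List Block) (cyc₀ : Cyclic L₀) (1≤R : 1 ≤ ow L₀)
           (rec : ∀ F → length F < length L₀ → Cyclic F → 1 ≤ ow F → Recursive F) where

    N R : ℕ
    N = tot L₀
    R = ow L₀

    -- Going round L₀ once changes N · own − R · size by zero, so this label depends only on the boundary.
    record Rotation (L : List Block) (g : ℕ) : Set where
      constructor rotation
      field
        α β   : List Block
        eqL   : L ≡ β ++ α
        eq₀   : L₀ ≡ α ++ β
        label : g ≡ N * ow α + R * tot β

    rotation-tot : ∀ {L g} → Rotation L g → tot L ≡ N
    rotation-tot (rotation α β refl eq₀ _) =
      trans (tot-++ β α) (trans (+-comm (tot β) _) (sym (trans (cong tot eq₀) (tot-++ α β))))

    rotation-ow : ∀ {L g} → Rotation L g → ow L ≡ R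
    rotation-ow (rotation α β refl eq₀ _) =
      trans (ow-++ β α) (trans (+-comm (ow β) _) (sym (trans (cong ow eq₀) (ow-++ α β))))

    rotation-length : ∀ {L g} → Rotation L g → length L ≡ length L₀
    rotation-length (rotation α β refl eq₀ _) =
      trans (length-++ β) (trans (+-comm (length β) _) (sym (trans (cong length eq₀) (length-++ α))))

    rotation-cyclic : ∀ {L g} → Rotation L g → Cyclic L
    rotation-cyclic (rotation α β refl eq₀ _) = cyclic-rotate α (subst Cyclic eq₀ cyc₀)

    rotation-solution : ∀ {L g m} → Rotation L g → Solution L m → Solution L₀ m
    rotation-solution {m = m} (rotation α β refl eq₀ _) S =
      subst (λ L → Solution L m) (sym eq₀) (solution-rotate β α S)

    -- For `β = []` the label is `N * R`, the same as for `α = []`, so the step equation also holds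
    -- across the seam of the circle.
    rotate₁ : ∀ {x xs g} → Rotation (x ∷ xs) g →
      ∃ λ g′ → Rotation (xs ++ x ∷ []) g′ × g′ + R * size x ≡ g + N * length (own x)
    rotate₁ {x} {xs} r@(rotation α [] refl eq₀ refl) =
      _ , rotation (x ∷ []) xs refl (trans eq₀ (++-identityʳ α)) refl ,
      trans (e N R (length (own x)) (size x) (tot xs) (sym (rotation-tot r)))
        (cong (λ z → N * z + R * 0 + N * length (own x)) (sym (rotation-ow r)))
      where
      ring : ∀ R p s t → (s + t) * (p + 0) + R * t + R * s ≡ (s + t) * R + R * 0 + (s + t) * p
      ring = solve-∀
      e : ∀ N R p s t → N ≡ s + t → N * (p + 0) + R * t + R * s ≡ N * R + R * 0 + N * p
      e _ R p s t refl = ring R p s t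
    rotate₁ {x} (rotation α (.x ∷ β) refl eq₀ refl) =
      _ , rotation (α ++ x ∷ []) β (++-assoc β α _) (trans eq₀ (sym (++-assoc α _ β))) refl ,
      trans (cong (λ z → N * z + R * tot β + R * size x) (ow-++ α (x ∷ [])))
        (ring N R (ow α) (length (own x)) (tot β) (size x))
      where
      ring : ∀ N R o p b s → N * (o + (p + 0)) + R * b + R * s ≡ N * o + R * (s + b) + N * p
      ring = solve-∀

    rotate : ∀ xs {ys g} → Rotation (xs ++ ys) g →
      ∃ λ g′ → Rotation (ys ++ xs) g′ × g′ + R * tot xs ≡ g + N * ow xs
    rotate [] {ys} {g} r = g , subst (λ L → Rotation L g) (sym (++-identityʳ ys)) r ,
      cong (g +_) (trans (*-zeroʳ R) (sym (*-zeroʳ N)))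
    rotate (x ∷ xs) {ys} {g} r with rotate₁ r
    ... | g₁ , rot₁ , e₁ with rotate xs (subst (λ L → Rotation L g₁) (++-assoc xs ys (x ∷ [])) rot₁)
    ... | g₂ , rot₂ , e₂ = g₂ , subst (λ L → Rotation L g₂) (++-assoc ys (x ∷ []) xs) rot₂ ,
      combine g g₁ g₂ R N (size x) (tot xs) (length (own x)) (ow xs) e₁ e₂
      where
      combine : ∀ g g₁ g₂ R N s t p o → g₁ + R * s ≡ g + N * p → g₂ + R * t ≡ g₁ + N * o →
        g₂ + R * (s + t) ≡ g + N * (p + o)
      combine g g₁ g₂ R N s t p o e₁ e₂ = begin
        g₂ + R * (s + t)        ≡⟨ r₁ g₂ R s t ⟩
        (g₂ + R * t) + R * s    ≡⟨ cong (_+ R * s) e₂ ⟩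
        (g₁ + N * o) + R * s    ≡⟨ r₂ g₁ N o R s ⟩
        (g₁ + R * s) + N * o    ≡⟨ cong (_+ N * o) e₁ ⟩
        (g + N * p) + N * o     ≡⟨ r₃ g N p o ⟩
        g + N * (p + o)         ∎
        where
        open ≡-Reasoning
        r₁ : ∀ g R s t → g + R * (s + t) ≡ (g + R * t) + R * s
        r₁ = solve-∀
        r₂ : ∀ g N o R s → (g + N * o) + R * s ≡ (g + R * s) + N * o
        r₂ = solve-∀
        r₃ : ∀ g N p o → (g + N * p) + N * o ≡ g + N * (p + o)
        r₃ = solve-∀

    -- Block t starts here, while m positions further on the last block of t ∷ Mid has M vertices left.
    record State (m : ℕ) : Set where
      field
        t         : Block
        Mid post  : List Block
        M gt gb   : ℕ
        rot       : Rotation (t ∷ Mid ++ post) gt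
        boundary  : gb + R * tot (t ∷ Mid) ≡ gt + N * ow (t ∷ Mid)
        len       : tot (t ∷ Mid) ≡ m + M
        last-big  : ∀ mid b → t ∷ Mid ≡ mid ++ b ∷ [] → M ≤ size b
        longer    : M < size t
      -- `gb + R * M` is the label at the end of the last block, moved back by `M` positions as if
      -- these held no own vertices. So the energy adds a potential at the start of `t` to one at
      -- the point opposite.
      energy : ℕ
      energy = gt + gb + R * M

    finish : ∀ t Mid post {m M g} → Rotation (t ∷ Mid ++ post) g → tot (t ∷ Mid) ≡ m + M →
      (∀ mid b → t ∷ Mid ≡ mid ++ b ∷ [] → M ≤ size b) → R * M ≤ length (own t) * N →
      Solution (t ∷ Mid ++ post) m
    finish t Mid post {m} {M} r len last dense with initLast Mid
    -- The arc starts and ends in the same block, so `t` has to supply both the cut and the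
    -- correction.
    ... | [] = finish-self t post (rotation-cyclic r) (trans (sym (+-identityʳ _)) len)
            (subst (1 ≤_) (sym (rotation-ow r)) 1≤R)
            (subst₂ (λ R N → R * M ≤ length (own t) * N) (sym (rotation-ow r)) (sym (rotation-tot r)) dense)
    ... | mid ∷ʳ′ b = subst (λ L → Solution (t ∷ L) m) (sym shape)
            (finish-other t mid b post (rotation-cyclic r′)
              (trans (cong (size t +_) (trans (cong (tot mid +_) (sym (+-identityʳ _))) (sym (tot-++ mid (b ∷ []))))) len)
              (last (t ∷ mid) b refl)
              (subst (1 ≤_) (sym (rotation-ow r′)) 1≤R)
              (subst₂ (λ R N → R * M ≤ length (own t) * N) (sym (rotation-ow r′)) (sym (rotation-tot r′)) dense))
      where
      shape : (mid ++ b ∷ []) ++ post ≡ mid ++ b ∷ post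
      shape = ++-assoc mid (b ∷ []) post
      r′ = subst (λ L → Rotation (t ∷ L) _) shape r

    double : ∀ t Mid F rest {m M g} → Rotation (t ∷ Mid ++ F ++ rest) g → tot (t ∷ Mid) ≡ m + M →
      M + tot F ≤ size t → 1 ≤ M → 2 * R * tot F ≤ ow F * N → R * (M + tot F) ≤ tot F * N →
      Solution (t ∷ Mid ++ F ++ rest) m
    double t Mid [] rest {M = M} r len fits 1≤M dbl fat =
      ⊥-elim (<⇒≱ (*-mono-≤ 1≤R (≤-trans 1≤M (m≤m+n M 0))) fat)
    double t Mid F@(f ∷ F′) rest {m} {M} r len fits 1≤M dbl fat =
      finish-double t Mid f F′ rest (rotation-cyclic r) (rec F shorter (cyclic-⊆ sub (rotation-cyclic r)) 1≤a)
        len fits (subst (1 ≤_) (sym (rotation-ow r)) 1≤R) 1≤a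
        (subst₂ (λ R N → 2 * R * tot F ≤ ow F * N) (sym (rotation-ow r)) (sym (rotation-tot r)) dbl)
        (subst₂ (λ R N → R * (M + tot F) ≤ tot F * N) (sym (rotation-ow r)) (sym (rotation-tot r)) fat)
      where
      sub : F ⊆ t ∷ Mid ++ F ++ rest
      sub = t ∷ʳ ⊆-++⁺ˡ Mid (⊆-++⁺ʳ rest ⊆-refl)
      shorter : length F < length L₀
      shorter = subst (length F <_) (rotation-length r) (s≤s (subst (length F ≤_) (sym (length-++ Mid))
        (≤-trans (subst (length F ≤_) (sym (length-++ F)) (m≤m+n _ _)) (m≤n+m _ (length Mid)))))
      -- Without own vertices in `F`, `dbl` would force `F` to be empty of vertices, and then `fat`
      -- fails because `R * M` is positive.
      positive : ∀ {R M f a N} → 1 ≤ R → 1 ≤ M → 2 * R * f ≤ a * N → R * (M + f) ≤ f * N → 1 ≤ a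
      positive {a = suc _} _ _ _ _ = s≤s z≤n
      positive {R} {M} {zero} {zero} 1≤R 1≤M _ fat = ⊥-elim (<⇒≱ (*-mono-≤ 1≤R (≤-trans 1≤M (m≤m+n M 0))) fat)
      positive {R} {M} {suc f} {zero} 1≤R 1≤M dbl _ =
        ⊥-elim (<⇒≱ (*-mono-≤ {1} (≤-trans 1≤R (m≤m+n R (R + 0))) (s≤s (z≤n {f}))) dbl)
      1≤a : 1 ≤ ow F
      1≤a = positive {R} {M} {tot F} {ow F} {N} 1≤R 1≤M dbl fat

    -- `t` contributes less than `R * M` since it is not dense. For `F`, either the density is below
    -- twice the average, or `F` is so short that even `a = f` stays within the bound.
    sparse : ∀ {p M f a} → ¬ (R * M ≤ p * N) → a ≤ f → ¬ (2 * R * f ≤ a * N × R * (M + f) ≤ f * N) →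
      N * a + N * p < (R * M + 2 * (R * f)) + R * M
    sparse {p} {M} {f} {a} ¬dense a≤f ¬double = +-mono-≤-< half (subst (_< R * M) (*-comm p N) (≰⇒> ¬dense))
      where
      open ≤-Reasoning
      half : N * a ≤ R * M + 2 * (R * f)
      half with 2 * R * f ≤? a * N
      ... | no ¬dbl = begin
        N * a                  ≡⟨ *-comm N a ⟩
        a * N                  ≤⟨ <⇒≤ (≰⇒> ¬dbl) ⟩
        2 * R * f              ≡⟨ *-assoc 2 R f ⟩
        2 * (R * f)            ≤⟨ m≤n+m _ (R * M) ⟩
        R * M + 2 * (R * f)    ∎
      ... | yes dbl = begin
        N * a                  ≤⟨ *-monoʳ-≤ N a≤f ⟩
        N * f                  ≡⟨ *-comm N f ⟩
        f * N                  ≤⟨ <⇒≤ (≰⇒> λ fat → ¬double (dbl , fat)) ⟩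
        R * (M + f)            ≡⟨ *-distribˡ-+ R M f ⟩
        R * M + R * f          ≤⟨ +-monoʳ-≤ (R * M) (m≤m+n (R * f) _) ⟩
        R * M + 2 * (R * f)    ∎

    -- Both points advance by `M + f` positions and exchange their roles. By the three label
    -- equations the energy changes by `N * (a + p) - 2 * R * (M + f)`, which the last hypothesis
    -- makes negative.
    energy-drop : ∀ {R N gt gb gt′ gb′ st tm om f a p M M′} →
      gb + R * (st + tm) ≡ gt + N * (p + om) →
      gt′ + R * (st + (tm + f)) ≡ gt + N * (p + (om + a)) →
      gb′ + R * st ≡ gt + N * p →
      M + f + M′ ≡ st →
      N * a + N * p < (R * M + 2 * (R * f)) + R * M →
      gt′ + gb′ + R * M′ < gt + gb + R * M
    energy-drop {R} {N} {gt} {gb} {gt′} {gb′} {st} {tm} {om} {f} {a} {p} {M} {M′} e₁ e₂ e₃ refl lt =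
      +-cancelʳ-< (R * f + R * (M + f)) _ _ (begin-strict
        gt′ + gb′ + R * M′ + (R * f + R * (M + f))    ≡⟨ r₁ gt′ gb′ R M′ f M ⟩
        (gt′ + R * f) + (gb′ + R * (M + f + M′))      ≡⟨ cong₂ _+_ step e₃ ⟩
        (gb + N * a) + (gt + N * p)                   ≡⟨ r₂ gb gt (N * a) (N * p) ⟩
        (gt + gb) + (N * a + N * p)                   <⟨ +-monoʳ-< (gt + gb) lt ⟩
        (gt + gb) + ((R * M + 2 * (R * f)) + R * M)   ≡⟨ r₃ (gt + gb) R M f ⟩
        gt + gb + R * M + (R * f + R * (M + f))       ∎)
      where
      r₁ : ∀ x y R M′ f M → x + y + R * M′ + (R * f + R * (M + f)) ≡ (x + R * f) + (y + R * (M + f + M′))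
      r₁ = solve-∀
      r₂ : ∀ x y z w → (x + z) + (y + w) ≡ (y + x) + (z + w)
      r₂ = solve-∀
      r₃ : ∀ x R M f → x + ((R * M + 2 * (R * f)) + R * M) ≡ x + R * M + (R * f + R * (M + f))
      r₃ = solve-∀
      r₄ : ∀ x R s t f → (x + R * f) + R * (s + t) ≡ x + R * (s + (t + f))
      r₄ = solve-∀
      r₅ : ∀ x N p o a → x + N * (p + (o + a)) ≡ (x + N * (p + o)) + N * a
      r₅ = solve-∀
      r₆ : ∀ x y z → (x + y) + z ≡ (x + z) + y
      r₆ = solve-∀
      step : gt′ + R * f ≡ gb + N * a
      step = +-cancelʳ-≡ (R * (st + tm)) _ _ (trans (r₄ gt′ R st tm f) (trans e₂ (trans (r₅ gt N p om a)
               (trans (cong (_+ N * a) (sym e₁)) (r₆ gb (R * (st + tm)) (N * a))))))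
      open ≤-Reasoning

    -- The stretches `A` and `Y` make up the whole circle, so their contributions `R * N` and
    -- `N * R` to the label cancel.
    new-boundary : ∀ {R N gt gt′ gb′ st p A oA Y oY} →
      gt′ + R * A ≡ gt + N * oA → gb′ + R * st ≡ gt + N * p → A + Y ≡ N → oA + oY ≡ R →
      gb′ + R * (Y + st) ≡ gt′ + N * (oY + p)
    new-boundary {R} {N} {gt} {gt′} {gb′} {st} {p} {A} {oA} {Y} {oY} e₁ e₂ eN eR = +-cancelʳ-≡ (R * A) _ _ (begin
      gb′ + R * (Y + st) + R * A        ≡⟨ r₁ gb′ R Y st A ⟩
      (gb′ + R * st) + R * (A + Y)      ≡⟨ cong₂ (λ x y → x + R * y) e₂ eN ⟩
      (gt + N * p) + R * N              ≡⟨ cong (λ x → (gt + N * p) + x * N) (sym eR) ⟩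
      (gt + N * p) + (oA + oY) * N      ≡⟨ r₂ gt N p oA oY ⟩
      (gt + N * oA) + N * (oY + p)      ≡⟨ cong (_+ N * (oY + p)) (sym e₁) ⟩
      (gt′ + R * A) + N * (oY + p)      ≡⟨ r₃ gt′ (R * A) (N * (oY + p)) ⟩
      gt′ + N * (oY + p) + R * A        ∎)
      where
      open ≡-Reasoning
      r₁ : ∀ g R Y s A → g + R * (Y + s) + R * A ≡ (g + R * s) + R * (A + Y)
      r₁ = solve-∀
      r₂ : ∀ g N p o o′ → (g + N * p) + (o + o′) * N ≡ (g + N * o) + N * (o′ + p)
      r₂ = solve-∀
      r₃ : ∀ x y z → (x + y) + z ≡ x + z + y
      r₃ = solve-∀

    new-length : ∀ {N m m′ st tm f M M′ Y} → m + m′ ≡ N → st + tm ≡ m + M → M + f + M′ ≡ st →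
      (st + (tm + f)) + Y ≡ N → Y + st ≡ m′ + M′
    new-length {N} {m} {m′} {st} {tm} {f} {M} {M′} {Y} eN len refl eY =
      trans (r₁ Y M f M′) (cong (_+ M′) (+-cancelˡ-≡ m _ _ (trans (r₂ m Y M f)
        (trans (cong (λ x → x + f + Y) (sym len)) (trans (r₃ (M + f + M′) tm f Y) (trans eY (sym eN)))))))
      where
      r₁ : ∀ Y M f M′ → Y + (M + f + M′) ≡ (Y + M + f) + M′
      r₁ = solve-∀
      r₂ : ∀ m Y M f → m + (Y + M + f) ≡ m + M + f + Y
      r₂ = solve-∀
      r₃ : ∀ s t f Y → s + t + f + Y ≡ (s + (t + f)) + Y
      r₃ = solve-∀

    -- The next arc is the complementary one: it starts right after `F`, ends inside `t` opposite to
    -- that place, and has target `m′`. What is left of `t` there is `M′ = size t - M - tot F`.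
    advance : ∀ {m m′} → m + m′ ≡ N → (s : State m) → let open State s in 1 ≤ M →
      ¬ (R * M ≤ length (own t) * N) → ∀ F rest → post ≡ F ++ rest → M + tot F ≤ size t →
      (rest ≡ [] ⊎ ∃₂ λ b post′ → rest ≡ b ∷ post′ × size t < M + tot F + size b) →
      ¬ (2 * R * tot F ≤ ow F * N × R * (M + tot F) ≤ tot F * N) →
      ∃ λ (s′ : State m′) → State.energy s′ < energy
    advance {m} {m′} eqN s 1≤M ¬dense F rest refl fits stop ¬double
      with m≤n⇒∃[o]m+o≡n fits | rotate₁ (State.rot s)
         | rotate (State.t s ∷ State.Mid s ++ F) {rest}
             (subst (λ L → Rotation (State.t s ∷ L) _) (sym (++-assoc (State.Mid s) F rest)) (State.rot s))
    ... | M′ , eqM | gb′ , _ , e₃ | gt′ , rot′ , e₂ = result stop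
      where
      open State s
      A≡ : tot (t ∷ Mid ++ F) ≡ size t + (tot Mid + tot F)
      A≡ = cong (size t +_) (tot-++ Mid F)
      oA≡ : ow (t ∷ Mid ++ F) ≡ length (own t) + (ow Mid + ow F)
      oA≡ = cong (length (own t) +_) (ow-++ Mid F)
      drop : gt′ + gb′ + R * M′ < energy
      drop = energy-drop {R} {N} {gt} {gb} {gt′} {gb′} {size t} {tot Mid} {ow Mid} {tot F} {ow F} {length (own t)} {M} {M′}
        boundary (subst₂ (λ x y → gt′ + R * x ≡ gt + N * y) A≡ oA≡ e₂) e₃ eqM
        (sparse {length (own t)} {M} {tot F} {ow F} ¬dense (ow≤tot F) ¬double)
      N≡ : tot (t ∷ Mid ++ F) + tot rest ≡ N
      N≡ = trans (sym (trans (tot-++ rest (t ∷ Mid ++ F)) (+-comm (tot rest) _))) (rotation-tot rot′)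
      R≡ : ow (t ∷ Mid ++ F) + ow rest ≡ R
      R≡ = trans (sym (trans (ow-++ rest (t ∷ Mid ++ F)) (+-comm (ow rest) _))) (rotation-ow rot′)
      boundary′ : gb′ + R * (tot rest + size t) ≡ gt′ + N * (ow rest + length (own t))
      boundary′ = new-boundary {R} {N} {gt} {gt′} {gb′} {size t} {length (own t)} e₂ e₃ N≡ R≡
      len′ : tot rest + size t ≡ m′ + M′
      len′ = new-length {N} {m} {m′} {size t} {tot Mid} {tot F} {M} {M′} {tot rest}
          eqN len eqM (trans (cong (_+ tot rest) (sym A≡)) N≡)
      M′≤t : M′ ≤ size t
      M′≤t = subst (M′ ≤_) eqM (m≤n+m M′ _)
      result : (rest ≡ [] ⊎ ∃₂ λ b post′ → rest ≡ b ∷ post′ × size t < M + tot F + size b) →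
        ∃ λ (s′ : State m′) → State.energy s′ < energy
      -- `F` reaches round to the start of `t`, so `t` is the next block itself, and `longer` comes
      -- from `1 ≤ M`.
      result (inj₁ refl) = record
        { t = t ; Mid = [] ; post = Mid ++ F ; M = M′ ; gt = gt′ ; gb = gb′
        ; rot      = rot′
        ; boundary = subst₂ (λ x y → gb′ + R * x ≡ gt′ + N * y) (sym (+-identityʳ _)) (sym (+-identityʳ _)) boundary′
        ; len      = trans (+-identityʳ _) len′
        ; last-big = λ { [] b refl → M′≤t ; (_ ∷ []) b () ; (_ ∷ _ ∷ _) b () }
        ; longer   = subst (M′ <_) eqM (m<n+m M′ (≤-trans 1≤M (m≤m+n M _))) } , drop
      result (inj₂ (b , post′ , refl , lt)) = record
        { t = b ; Mid = post′ ++ t ∷ [] ; post = Mid ++ F ; M = M′ ; gt = gt′ ; gb = gb′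
        ; rot      = subst (λ L → Rotation (b ∷ L) gt′) (sym (++-assoc post′ (t ∷ []) (Mid ++ F))) rot′
        ; boundary = subst₂ (λ x y → gb′ + R * x ≡ gt′ + N * y) (sym tot≡) (sym ow≡) boundary′
        ; len      = trans tot≡ len′
        ; last-big = λ mid b′ eq → subst (λ x → M′ ≤ size x) (∷ʳ-injectiveʳ (b ∷ post′) mid eq) M′≤t
        ; longer   = +-cancelˡ-< (M + tot F) _ _ (subst (_< M + tot F + size b) (sym eqM) lt) } , drop
        where
        tot≡ : tot (b ∷ post′ ++ t ∷ []) ≡ tot (b ∷ post′) + size t
        tot≡ = trans (tot-++ (b ∷ post′) (t ∷ [])) (cong (tot (b ∷ post′) +_) (+-identityʳ _))
        ow≡ : ow (b ∷ post′ ++ t ∷ []) ≡ ow (b ∷ post′) + length (own t)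
        ow≡ = trans (ow-++ (b ∷ post′) (t ∷ [])) (cong (ow (b ∷ post′) +_) (+-identityʳ _))

    -- Labels are tied to boundaries of `L₀`, so the energy does not drift over several rounds, and
    -- its strict decrease makes the walk end.
    walk : ∀ {m m′} → m + m′ ≡ N → (s : State m) → Acc _<_ (State.energy s) → Solution L₀ m
    walk {m} {m′} eqN s (acc smaller) with R * State.M s ≤? length (own (State.t s)) * N
    ... | yes dense = rotation-solution rot (finish t Mid post rot len last-big dense)
      where open State s
    ... | no ¬dense with scan (size (State.t s)) (State.M s) (State.post s) (<⇒≤ (State.longer s))
    ... | F , rest , eq , fits , stop
      with (2 * R * tot F ≤? ow F * N) ×-dec (R * (State.M s + tot F) ≤? tot F * N)
         -- For `M = 0` the dense case would have applied.
         | n≢0⇒n>0 {State.M s}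
             (λ M≡0 → ¬dense (subst (_≤ length (own (State.t s)) * N) (sym (trans (cong (R *_) M≡0) (*-zeroʳ R))) z≤n))
    ... | yes (dbl , fat) | 1≤M = rotation-solution rot (subst (λ post → Solution (t ∷ Mid ++ post) m) (sym eq)
            (double t Mid F rest (subst (λ post → Rotation (t ∷ Mid ++ post) gt) eq rot) len fits 1≤M dbl fat))
      where open State s
    ... | no ¬double | 1≤M with advance eqN s 1≤M ¬dense F rest eq fits stop ¬double
    ... | s′ , lt = solution-swap (trans (+-comm m′ m) eqN) (walk (trans (+-comm m′ m) eqN) s′ (smaller lt))

    -- A state needs `M < size t`. As long as this fails, `t` is dropped from the front: the start
    -- and the point `m` positions later move on together by `size t`, and `M` shrinks by that
    -- amount.
    start : ∀ t Mid post {m m′ M g} → m + m′ ≡ N → 1 ≤ m → Rotation (t ∷ Mid ++ post) g → tot (t ∷ Mid) ≡ m + M →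
      (∀ mid b → t ∷ Mid ≡ mid ++ b ∷ [] → M ≤ size b) → Solution L₀ m
    start t Mid post {M = M} eqN 1≤m r len last with M <? size t
    ... | yes M<t with rotate (t ∷ Mid) r
    ... | gb , _ , boundary = walk eqN
        (record { rot = r ; boundary = boundary ; len = len ; last-big = last ; longer = M<t })
            (<-wellFounded _)
    start t [] post {m} {M = M} eqN 1≤m r len last | no M≮t =
      ⊥-elim (M≮t (subst (M <_) (trans (sym len) (+-identityʳ _)) (m<n+m M 1≤m)))
    start t (t′ ∷ Mid) post {m} {M = M} {g} eqN 1≤m r len last | no M≮t with m≤n⇒∃[o]m+o≡n (≮⇒≥ M≮t) | rotate₁ r
    ... | M′ , refl | g′ , r′ , _ = start t′ Mid (post ++ t ∷ []) eqN 1≤m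
            (subst (λ L → Rotation (t′ ∷ L) g′) (++-assoc Mid post (t ∷ [])) r′)
            (+-cancelˡ-≡ (size t) _ _ (trans len (ring m (size t) M′)))
            (λ mid b eq → ≤-trans (m≤n+m M′ (size t)) (last (t ∷ mid) b (cong (t ∷_) eq)))
      where
      ring : ∀ a b c → a + (b + c) ≡ b + (a + c)
      ring = solve-∀

  main : ∀ L → Acc _<_ (length L) → Cyclic L → 1 ≤ ow L → Recursive L
  main L _ _ _ zero _ = record
    { B = [] ; W = flatten L ; bags = [] ; perm = ↭-refl ; sizeB = refl ; covers = λ () ; bound = λ _ _ _ _ → z≤n }
  main [] _ _ () (suc m) m≤
  main L@(t ∷ ts) (acc smaller) cyc 1≤R m@(suc _) m≤ with locate t ts m m≤ | m≤n⇒∃[o]m+o≡n m≤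
  ... | Mid , post , M , refl , len , last | m′ , eqN =
    start L cyc 1≤R (λ F lt → main F (smaller lt)) t Mid post eqN (s≤s z≤n)
      (rotation [] L (sym (++-identityʳ L)) refl refl) len last

  solve-blocks : ∀ L → Cyclic L → 1 ≤ ow L → ∀ m → m ≤ tot L → Solution L m
  solve-blocks L = main L (<-wellFounded _)

  -- Rooted decompositions

  -- First-child, next-sibling encoding. The order of children matters: the first child continues
  -- the distinguished path.
  data Forest : Set where
    nil  : Forest
    cons : (j : Fin k) (kids sibs : Forest) → Forest

  new : Fin k → Fin k → List (Fin n)
  new par j = filter (λ v → (v ∈? X j) ×-dec ¬? (v ∈? X par)) (allFin n)

  new⊆ : ∀ par j {v} → v ∈ₗ new par j → v ∈ X j
  new⊆ par j v∈ = proj₁ (proj₂ (∈-filter⁻ (λ v → (v ∈? X j) ×-dec ¬? (v ∈? X par)) {xs = allFin n} v∈))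

  verts : Fin k → Forest → List (Fin n)
  verts par nil = []
  verts par (cons j ks ss) = (new par j ++ verts j ks) ++ verts par ss

  LeavesVia : Fin k → List (Fin n) → Set
  LeavesVia par xs = ∀ {u v} → u ∈ₗ xs → v ∉ₗ xs → Edge G u v → v ∈ X par

  Separates : Fin k → Forest → Set
  Separates par nil = ⊤
  Separates par (cons j ks ss) = LeavesVia par (new par j ++ verts j ks) × Separates j ks × Separates par ss

  leaves-forest : ∀ {par} f → Separates par f → LeavesVia par (verts par f)
  leaves-forest {par} (cons j ks ss) (leaves , _ , sep) u∈ v∉ e with ∈-++⁻ (new par j ++ verts j ks) u∈
  ... | inj₁ p = leaves p (v∉ ∘ ∈-++⁺ˡ) e
  ... | inj₂ p = leaves-forest ss sep p (v∉ ∘ ∈-++⁺ʳ (new par j ++ verts j ks)) e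

  module _ {P : Fin n → Set} (P? : Decidable P) where

    -- `P` stands for the vertices left over by earlier cuts. Those outside `P` end up on the same
    -- side as the new piece, so edges to them are not cut.
    Closed : Fin k → List (Fin n) → Set
    Closed c xs = ∀ {u v} → u ∈ₗ xs → P v → v ∉ₗ xs → Edge G u v → Touch c u v

    record Half (U : List (Fin n)) (w : ℕ) : Set where
      field
        {C D}  : List (Fin n)
        bag    : Fin k
        perm   : C ++ D ↭ U
        closed : Closed bag C
        small  : length C ≤ w
        large  : w ≤ 2 * length C

    -- A is a union of complete subtrees below par, still too small.
    half-cut : ∀ par f A o {w} → (∀ {v} → v ∈ₗ o → v ∈ X par) → Separates par f → Closed par A → 2 * length A ≤ w →
      w ≤ length (A ++ filter P? o ++ filter P? (verts par f)) → Half (A ++ filter P? o ++ filter P? (verts par f)) w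
    -- No subtree remains, so `A` is filled up to exactly `w` with vertices of `o`; they lie in the
    -- bag of `par`, hence any of them may be taken.
    half-cut par nil A o {w} o⊆ _ closedA A≤ w≤
      with m≤n⇒∃[o]m+o≡n (≤-trans (m≤m+n (length A) (length A + 0)) A≤)
    ... | z , eqz with split-list z (filter P? o) (+-cancelˡ-≤ (length A) _ _ (subst₂ _≤_ (sym eqz)
                         (trans (length-++ A) (cong (λ xs → length A + length xs) (++-identityʳ (filter P? o)))) w≤))
    ... | o₁ , o₂ , eqo , refl = record
      { C = A ++ o₁ ; D = o₂ ; bag = par
      ; perm = ↭-reflexive (trans (++-assoc A o₁ o₂) (cong (A ++_) (trans (sym eqo) (sym (++-identityʳ (filter P? o))))))
      ; closed = λ u∈ pv v∉ e →
            [ (λ p → closedA p pv (v∉ ∘ ∈-++⁺ˡ) e) , (λ p → inj₁ (o⊆ (proj₁ (∈-filter⁻ P? (subst (_ ∈ₗ_) (sym eqo) (∈-++⁺ˡ p)))))) ]′ (∈-++⁻ A u∈)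
      ; small = ≤-reflexive len ; large = ≤-trans (≤-reflexive (sym len)) (m≤m+n _ _) }
      where
      len : length (A ++ o₁) ≡ w
      len = trans (length-++ A) eqz
    half-cut par (cons j ks ss) A o {w} o⊆ (leaves , sepk , seps) closedA A≤ w≤
      = go (length A + length c ≤? w) (length c ≤? w)
      where
      tree = new par j ++ verts j ks
      c = filter P? tree
      E = filter P? (verts par ss)
      whole : filter P? (verts par (cons j ks ss)) ≡ c ++ E
      whole = filter-++ P? tree (verts par ss)
      closed-c : Closed par c
      closed-c u∈ pv v∉ e = inj₂ (leaves (proj₁ (∈-filter⁻ P? u∈)) (λ v∈ → v∉ (∈-filter⁺ P? v∈ pv)) e)
      closed-Ac : Closed par (A ++ c)
      closed-Ac u∈ pv v∉ e with ∈-++⁻ A u∈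
      ... | inj₁ p = closedA p pv (v∉ ∘ ∈-++⁺ˡ) e
      ... | inj₂ p = closed-c p pv (v∉ ∘ ∈-++⁺ʳ A) e
      permAc : (A ++ c) ++ filter P? o ++ E ↭ A ++ filter P? o ++ filter P? (verts par (cons j ks ss))
      permAc = ↭-trans (solve 4 (λ A c o E → (A ⊕ c) ⊕ (o ⊕ E) ⊜ A ⊕ (o ⊕ (c ⊕ E))) ↭-refl A c (filter P? o) E)
                 (↭-reflexive (cong (λ z → A ++ filter P? o ++ z) (sym whole)))
      w≤Ac : w ≤ length ((A ++ c) ++ filter P? o ++ E)
      w≤Ac = subst (w ≤_) (↭-length (↭-sym permAc)) w≤
      rest : ∀ C D → C ++ D ↭ c → C ++ (D ++ A ++ filter P? o ++ E) ↭
          A ++ filter P? o ++ filter P? (verts par (cons j ks ss))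
      rest C D p = ↭-trans (solve 5 (λ C D A o E → C ⊕ (D ⊕ (A ⊕ (o ⊕ E))) ⊜ (A ⊕ (C ⊕ D)) ⊕ (o ⊕ E))
          ↭-refl C D A (filter P? o) E)
                         (↭-trans (++⁺ (++⁺ (↭-refl {x = A}) p) ↭-refl) permAc)
      go : _ → _ → Half (A ++ filter P? o ++ filter P? (verts par (cons j ks ss))) w
      go (yes fits) _ with w ≤? 2 * length (A ++ c)
      ... | yes enough = record { C = A ++ c ; D = filter P? o ++ E ; bag = par ; perm = permAc ; closed = closed-Ac
                                ; small = subst (_≤ w) (sym (length-++ A)) fits ; large = enough }
      ... | no ¬enough = record { H ; perm = ↭-trans H.perm permAc }
        where
        module H = Half (half-cut par ss (A ++ c) o o⊆ seps closed-Ac (<⇒≤ (≰⇒> ¬enough)) w≤Ac)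
      -- `A` has at most `w / 2` vertices and together with `c` exceeds `w`, so `c` alone has at
      -- least `w / 2`.
      go (no ¬fits) (yes c≤w) = record { C = c ; bag = par ; perm = rest c [] (↭-reflexive (++-identityʳ c))
          ; closed = closed-c ; small = c≤w
        ; large = +-cancelˡ-≤ w _ _ (begin
            w + w                            ≤⟨ +-mono-≤ (<⇒≤ (≰⇒> ¬fits)) (<⇒≤ (≰⇒> ¬fits)) ⟩
            (a + length c) + (a + length c)  ≡⟨ ring a (length c) ⟩
            2 * a + 2 * length c             ≤⟨ +-monoˡ-≤ (2 * length c) A≤ ⟩
            w + 2 * length c                 ∎) }
        where
        open ≤-Reasoning
        a = length A
        ring : ∀ a c → (a + c) + (a + c) ≡ 2 * a + 2 * c
        ring = solve-∀
      -- This subtree alone is too large: descend into it with empty `A`, the new vertices of `j`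
      -- taking the role of `o`.
      go (no _) (no c≰w) = record { H ; D = H.D ++ A ++ filter P? o ++ E
        ; perm = rest H.C H.D (↭-trans H.perm (↭-reflexive (sym (filter-++ P? (new par j) (verts j ks))))) }
        where
        w≤c : w ≤ length (filter P? (new par j) ++ filter P? (verts j ks))
        w≤c = subst (λ z → w ≤ length z) (filter-++ P? (new par j) (verts j ks)) (<⇒≤ (≰⇒> c≰w))
        module H = Half (half-cut j ks [] (new par j) (new⊆ par j) sepk (λ ()) z≤n w≤c)

  -- Each round of `half-cut` costs one bag and at least halves the missing amount. The forest is
  -- kept fixed and only the predicate shrinks, because the remaining vertices need not be all
  -- vertices of a forest.
  approx-cut : ∀ par f o → (∀ {v} → v ∈ₗ o → v ∈ X par) → Separates par f → Unique (o ++ verts par f) →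
    ∀ {P : Fin n → Set} (P? : Decidable P) w j → Approx (filter P? (o ++ verts par f)) w j
  approx-cut par f o o⊆ sep uniq P? w zero = record
    { C = [] ; D = filter P? (o ++ verts par f) ; bags = [] ; perm = ↭-refl ; covers = λ ()
          ; few = z≤n ; small = z≤n ; near = inj₂ (≤-reflexive (+-identityʳ w)) }
  approx-cut par f o o⊆ sep uniq {P} P? w (suc j) with w ≤? length (filter P? (o ++ verts par f))
  ... | no w≰ = record
    { C = filter P? (o ++ verts par f) ; D = [] ; bags = [] ; perm = ↭-reflexive (++-identityʳ _) ; covers = λ _ ()
    ; few = z≤n ; small = <⇒≤ (≰⇒> w≰) ; near = inj₁ refl }
  ... | yes w≤ with half-cut P? par f [] o o⊆ sep (λ ()) z≤n (subst (λ z → w ≤ length z) (filter-++ P? o (verts par f)) w≤)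
  ... | H with m≤n⇒∃[o]m+o≡n (Half.small H)
  ... | w′ , eqw = record
    { C = H.C ++ A.C ; D = A.D ; bags = H.bag ∷ A.bags
    ; perm = ↭-trans (↭-reflexive (++-assoc H.C A.C A.D)) (↭-trans (++⁺ (↭-refl {x = H.C}) (↭-trans A.perm D≡)) permU)
    ; covers = covers-++ˡ H.C (λ u∈ v∈ e → here (H.closed u∈ (proj₁ (inD v∈)) (proj₂ (inD v∈)) e))
          (λ u∈ v∈ e → there (A.covers u∈ v∈ e))
    ; few = s≤s A.few
    ; small = subst₂ _≤_ (sym (length-++ H.C)) eqw (+-monoʳ-≤ (length H.C) A.small)
    ; near = Sum.map₂ closer A.near }
    where
    U = filter P? (o ++ verts par f)
    module H = Half H
    Q? : Decidable (λ v → v ∉ₗ H.C)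
    Q? v = ¬? (v ∈ₗ? H.C)
    PQ? = λ v → P? v ×-dec Q? v
    module A = Approx (approx-cut par f o o⊆ sep uniq PQ? w′ j)
    permU : H.C ++ H.D ↭ U
    permU = ↭-trans H.perm (↭-reflexive (sym (filter-++ P? o (verts par f))))
    disjoint : ∀ {v} → v ∈ₗ H.C → v ∉ₗ H.D
    disjoint = proj₂ (proj₂ (unique-++⁻ H.C (unique-↭ (↭-sym permU) (Uniqueₚ.filter⁺ P? uniq))))
    D≡ : filter PQ? (o ++ verts par f) ↭ H.D
    D≡ = ↭-trans (↭-reflexive (sym (filter-filter P? Q? (o ++ verts par f)))) (↭-trans (filter-↭ Q? (↭-sym permU))
           (↭-reflexive (trans (filter-++ Q? H.C H.D) (cong₂ _++_
             (filter-none Q? (All.tabulate λ v∈ ¬v∈ → ¬v∈ v∈))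
             (filter-all Q? (All.tabulate λ v∈D v∈C → disjoint v∈C v∈D))))))
    inD : ∀ {v} → v ∈ₗ A.D → P v × v ∉ₗ H.C
    inD v∈ = proj₂ (∈-filter⁻ PQ? {xs = o ++ verts par f} (∈-resp-↭ A.perm (∈-++⁺ʳ A.C v∈)))
    closer : 2 ^ j * w′ ≤ 2 ^ j * length A.C + w′ → 2 ^ suc j * w ≤ 2 ^ suc j * length (H.C ++ A.C) + w
    closer le = begin
      2 ^ suc j * w                                  ≡⟨ cong (2 ^ suc j *_) (sym eqw) ⟩
      2 ^ suc j * (c + w′)                           ≡⟨ r₁ (2 ^ j) c w′ ⟩
      2 ^ suc j * c + 2 * (2 ^ j * w′)               ≤⟨ +-monoʳ-≤ (2 ^ suc j * c) (*-monoʳ-≤ 2 le) ⟩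
      2 ^ suc j * c + 2 * (2 ^ j * a + w′)           ≡⟨ r₂ (2 ^ j) c a w′ ⟩
      2 ^ suc j * (c + a) + (w′ + w′)
          ≤⟨ +-monoʳ-≤ (2 ^ suc j * (c + a)) (≤-trans (+-monoˡ-≤ w′ w′≤c) (≤-reflexive eqw)) ⟩
      2 ^ suc j * (c + a) + w                        ≡⟨ cong (λ z → 2 ^ suc j * z + w) (sym (length-++ H.C)) ⟩
      2 ^ suc j * length (H.C ++ A.C) + w            ∎
      where
      open ≤-Reasoning
      c = length H.C
      a = length A.C
      w′≤c : w′ ≤ c
      w′≤c = +-cancelˡ-≤ c _ _ (subst₂ _≤_ (sym eqw) (cong (c +_) (+-identityʳ c)) H.large)
      r₁ : ∀ e c w → (2 * e) * (c + w) ≡ (2 * e) * c + 2 * (e * w)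
      r₁ = solve-∀
      r₂ : ∀ e c a w → (2 * e) * c + 2 * (e * a + w) ≡ (2 * e) * (c + a) + (w + w)
      r₂ = solve-∀

  approx-cut-all : ∀ par f o → (∀ {v} → v ∈ₗ o → v ∈ X par) → Separates par f → Unique (o ++ verts par f) →
    ∀ w j → Approx (o ++ verts par f) w j
  approx-cut-all par f o o⊆ sep uniq w j = subst (λ U → Approx U w j)
    (filter-all (λ _ → yes tt) (All.tabulate {xs = o ++ verts par f} (λ _ → tt)))
        (approx-cut par f o o⊆ sep uniq (λ _ → yes tt) w j)

  -- Blocks along the path of first children.

  block : ∀ h o ss → All (_∈ X h) o → Separates h ss → Unique (o ++ verts h ss) → Block
  block h o ss o⊆ sep uniq = record
    { hub = h ; own = o ; hang = verts h ss ; own⊆hub = All.lookup o⊆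
    ; cut = approx-cut-all h ss o (All.lookup o⊆) sep uniq
    ; cut-hang = approx-cut-all h ss [] (λ ()) sep (proj₁ (proj₂ (unique-++⁻ o uniq))) }

  unique-exchange : ∀ o T S → Unique (o ++ T ++ S) → Unique (o ++ S) × Unique T × (∀ {v : Fin n} → v ∈ₗ o ++ S → v ∉ₗ T)
  unique-exchange o T S u = unique-++⁻ (o ++ S) (unique-↭ (solve 3 (λ o t s → o ⊕ (t ⊕ s) ⊜ (o ⊕ s) ⊕ t) ↭-refl o T S) u)

  -- The siblings of the first child `j` hang off `h`. The descent goes on to a leaf, possibly past
  -- the chosen path, which can only add own vertices.
  spine : ∀ o h ks → All (_∈ X h) o → Separates h ks → Unique (o ++ verts h ks) → List Block
  spine o h nil o⊆ sep uniq = block h o nil o⊆ sep uniq ∷ []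
  spine o h (cons j ks ss) o⊆ (_ , sepk , seps) uniq =
    let uniq-s , uniq-k , _ = unique-exchange o (new h j ++ verts j ks) (verts h ss) uniq in
    block h o ss o⊆ seps uniq-s ∷ spine (new h j) j ks (All.tabulate (new⊆ h j)) sepk uniq-k

  flatten-spine : ∀ o h ks o⊆ sep uniq → flatten (spine o h ks o⊆ sep uniq) ↭ o ++ verts h ks
  flatten-spine o h nil o⊆ sep uniq = ↭-reflexive (++-identityʳ _)
  flatten-spine o h (cons j ks ss) o⊆ (_ , sepk , seps) uniq =
    ↭-trans (++⁺ (↭-refl {x = o ++ verts h ss}) (flatten-spine (new h j) j ks _ _ _))
      (solve 3 (λ o t s → (o ⊕ s) ⊕ t ⊜ o ⊕ (t ⊕ s)) ↭-refl o (new h j ++ verts j ks) (verts h ss))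

  ∈-flatten⁺ : ∀ {b v} bs → b ∈ₗ bs → v ∈ₗ els b → v ∈ₗ flatten bs
  ∈-flatten⁺ (b ∷ bs) (here refl) v∈ = ∈-++⁺ˡ v∈
  ∈-flatten⁺ (b ∷ bs) (there p) v∈ = ∈-++⁺ʳ (els b) (∈-flatten⁺ bs p v∈)

  ∈-spine : ∀ o h ks o⊆ sep uniq {b v} → b ∈ₗ spine o h ks o⊆ sep uniq → v ∈ₗ els b → v ∈ₗ o ++ verts h ks
  ∈-spine o h ks o⊆ sep uniq b∈ v∈ = ∈-resp-↭ (flatten-spine o h ks o⊆ sep uniq) (∈-flatten⁺ _ b∈ v∈)

  beyond : Fin k → Forest → List (Fin n)
  beyond h nil = []
  beyond h (cons j ks ss) = new h j ++ verts j ks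

  beyond⊆ : ∀ h ks {v} → v ∈ₗ beyond h ks → v ∈ₗ verts h ks
  beyond⊆ h (cons j ks ss) v∈ = ∈-++⁺ˡ v∈

  -- `y` lies in the subtree of the first child of `hub s` and `u` does not, so the edge leaves that
  -- subtree through the bag of `hub s`. Excluding `u` from the topmost such subtree serves every
  -- later `s`, as these subtrees are nested.
  touch-earlier : ∀ o h ks o⊆ sep uniq {s y u v} → (s ∷ y ∷ []) ⊆ spine o h ks o⊆ sep uniq →
    u ∉ₗ beyond h ks → v ∈ₗ els y → Edge G u v → u ∈ X (Block.hub s)
  touch-earlier o h nil o⊆ sep uniq (_ ∷ʳ ()) u∉ v∈ e
  touch-earlier o h nil o⊆ sep uniq (_ ∷ ()) u∉ v∈ e
  touch-earlier o h (cons j ks ss) o⊆ (leaves , sepk , seps) uniq (refl ∷ sub) u∉ v∈ e =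
    leaves (∈-spine (new h j) j ks _ _ _ (to∈ sub) v∈) u∉ (Edge-sym e)
  touch-earlier o h (cons j ks ss) o⊆ (leaves , sepk , seps) uniq (_ ∷ʳ sub) u∉ v∈ e =
    touch-earlier (new h j) j ks _ _ _ sub (λ p → u∉ (∈-++⁺ʳ (new h j) (beyond⊆ j ks p))) v∈ e

  -- Vertices of `x` lie outside everything below the next path node, so `touch-earlier` applies
  -- from there on.
  touch-between : ∀ o h ks o⊆ sep uniq {x s y u v} → (x ∷ s ∷ y ∷ []) ⊆ spine o h ks o⊆ sep uniq →
    u ∈ₗ els x → v ∈ₗ els y → Edge G u v → u ∈ X (Block.hub s)
  touch-between o h nil o⊆ sep uniq (_ ∷ʳ ()) u∈ v∈ e
  touch-between o h nil o⊆ sep uniq (_ ∷ ()) u∈ v∈ e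
  touch-between o h (cons j ks ss) o⊆ (leaves , sepk , seps) uniq (refl ∷ sub) u∈ v∈ e =
    touch-earlier (new h j) j ks _ _ _ sub
      (λ p → proj₂ (proj₂ (unique-exchange o (new h j ++ verts j ks) (verts h ss) uniq))
          u∈ (∈-++⁺ʳ (new h j) (beyond⊆ j ks p))) v∈ e
  touch-between o h (cons j ks ss) o⊆ (leaves , sepk , seps) uniq (_ ∷ʳ sub) u∈ v∈ e =
    touch-between (new h j) j ks _ _ _ sub u∈ v∈ e

  touch-first : ∀ o h ks o⊆ sep uniq {x y u v} → (x ∷ y ∷ []) ⊆ spine o h ks o⊆ sep uniq →
    u ∈ₗ els x → v ∈ₗ els y → Edge G u v → u ∈ X (Block.hub x) × u ∉ₗ els y
  touch-first o h nil o⊆ sep uniq (_ ∷ʳ ()) u∈ v∈ e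
  touch-first o h nil o⊆ sep uniq (_ ∷ ()) u∈ v∈ e
  touch-first o h (cons j ks ss) o⊆ sep@(leaves , sepk , seps) uniq (refl ∷ sub) u∈ v∈ e =
    touch-earlier o h (cons j ks ss) o⊆ sep uniq (refl ∷ sub) (disj u∈) v∈ e ,
    λ u∈y → disj u∈ (∈-spine (new h j) j ks _ _ _ (to∈ sub) u∈y)
    where disj = proj₂ (proj₂ (unique-exchange o (new h j ++ verts j ks) (verts h ss) uniq))
  touch-first o h (cons j ks ss) o⊆ (leaves , sepk , seps) uniq (_ ∷ʳ sub) u∈ v∈ e =
    touch-first (new h j) j ks _ _ _ sub u∈ v∈ e

  touch-block : ∀ h o ss → All (_∈ X h) o → Separates h ss → ∀ {u v} →
      u ∉ₗ o ++ verts h ss → v ∈ₗ o ++ verts h ss → Edge G u v → Touch h u v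
  touch-block h o ss o⊆ sep u∉ v∈ e with ∈-++⁻ o v∈
  ... | inj₁ p = inj₂ (All.lookup o⊆ p)
  ... | inj₂ p = inj₁ (leaves-forest ss sep p (u∉ ∘ ∈-++⁺ʳ o) (Edge-sym e))

  touch-own : ∀ o h ks o⊆ sep uniq {y u v} → y ∈ₗ spine o h ks o⊆ sep uniq →
    u ∉ₗ els y → v ∈ₗ els y → Edge G u v → Touch (Block.hub y) u v
  touch-own o h nil o⊆ sep uniq (here refl) = touch-block h o nil o⊆ sep
  touch-own o h (cons j ks ss) o⊆ (_ , _ , seps) uniq (here refl) = touch-block h o ss o⊆ seps
  touch-own o h (cons j ks ss) o⊆ (_ , sepk , _) uniq (there y∈) = touch-own (new h j) j ks _ sepk _ y∈

  -- In the linear order the middle block separates: `c` stands between `b` and `d`, and `b` between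
  -- `a` and `c`.
  spine-cyclic : ∀ o h ks o⊆ sep uniq → Cyclic (spine o h ks o⊆ sep uniq)
  spine-cyclic o h ks o⊆ sep uniq = record
    { pairs = λ sub u∈ v∈ e → let u∈X , u∉y = touch-first o h ks o⊆ sep uniq sub u∈ v∈ e in
        inj₁ u∈X , touch-own o h ks o⊆ sep uniq (to∈ (∷ˡ⁻ sub)) u∉y v∈ e
    ; quadruple = λ {a} {b} {c} {d} sub →
        (λ u∈ v∈ e → inj₂ (inj₁ (touch-between o h ks o⊆ sep uniq (∷ˡ⁻ sub) u∈ v∈ e))) ,
        (λ u∈ v∈ e → inj₁ (inj₁ (touch-between o h ks o⊆ sep uniq (⊆-trans (refl ∷ refl ∷ refl ∷ d ∷ʳ []) sub) u∈ v∈ e))) }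

  -- Turning the tree `T` into a forest below a prescribed path.

  module Rooting (T : Graph k) where

    nodes : Forest → List (Fin k)
    nodes nil = []
    nodes (cons j ks ss) = (j ∷ nodes ks) ++ nodes ss

    Edgeᵀ-sym : ∀ {x y} → Edge T x y → Edge T y x
    Edgeᵀ-sym {x} {y} e rewrite Graph.sym T x y = e

    ExitsVia : List (Fin k) → Fin k → List (Fin k) → Set
    ExitsVia U par S = ∀ {x y} → x ∈ₗ S → y ∈ₗ U → y ∉ₗ S → Edge T x y → y ≡ par

    -- U is the set of nodes placed so far.
    Rooted : List (Fin k) → Fin k → Forest → Set
    Rooted U par nil = ⊤
    Rooted U par (cons j ks ss) = ExitsVia U par (j ∷ nodes ks) × Rooted U j ks × Rooted U par ss

    rooted-⊆ : ∀ {U U′ par} f → (∀ {y} → y ∈ₗ U′ → y ∈ₗ U) → Rooted U par f → Rooted U′ par f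
    rooted-⊆ nil _ _ = tt
    rooted-⊆ (cons j ks ss) sub (exits , rk , rs) =
      (λ x∈ y∈ → exits x∈ (sub y∈)) , rooted-⊆ ks sub rk , rooted-⊆ ss sub rs

    -- New children are placed last, so that an existing first child stays first and the prescribed
    -- path is preserved.
    append : Forest → Fin k → Forest
    append nil b = cons b nil nil
    append (cons j ks ss) b = cons j ks (append ss b)

    nodes-append : ∀ f b → nodes (append f b) ↭ b ∷ nodes f
    nodes-append nil b = ↭-refl
    nodes-append (cons j ks ss) b = ↭-trans (++⁺ˡ (j ∷ nodes ks) (nodes-append ss b)) (shift b (j ∷ nodes ks) (nodes ss))

    insert : ∀ f {a} → a ∈ₗ nodes f → Fin k → Forest
    insert (cons j ks ss) p b with ∈-++⁻ (j ∷ nodes ks) p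
    ... | inj₁ (here _)  = cons j (append ks b) ss
    ... | inj₁ (there q) = cons j (insert ks q b) ss
    ... | inj₂ q         = cons j ks (insert ss q b)

    nodes-insert : ∀ f {a} (p : a ∈ₗ nodes f) b → nodes (insert f p b) ↭ b ∷ nodes f
    nodes-insert (cons j ks ss) p b with ∈-++⁻ (j ∷ nodes ks) p
    ... | inj₁ (here _)  = ↭-trans (prep j (++⁺ʳ (nodes ss) (nodes-append ks b))) (swap j b ↭-refl)
    ... | inj₁ (there q) = ↭-trans (prep j (++⁺ʳ (nodes ss) (nodes-insert ks q b))) (swap j b ↭-refl)
    ... | inj₂ q         = ↭-trans (++⁺ˡ (j ∷ nodes ks) (nodes-insert ss q b)) (shift b (j ∷ nodes ks) (nodes ss))

    module _ {U : List (Fin k)} {a b : Fin k} (b∉U : b ∉ₗ U) (only : ∀ {x} → x ∈ₗ U → Edge T x b → x ≡ a) where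

      -- Among the placed nodes `b` is adjacent to `a` only, so a subtree without `a` gets no new
      -- exit.
      exits-extend : ∀ {par S} → (∀ {x} → x ∈ₗ S → x ∈ₗ U) → a ∉ₗ S → ExitsVia U par S → ExitsVia (b ∷ U) par S
      exits-extend S⊆ a∉ exits x∈ (here refl) y∉ e = ⊥-elim (a∉ (subst (_∈ₗ _) (only (S⊆ x∈) e) x∈))
      exits-extend S⊆ a∉ exits x∈ (there y∈) y∉ e = exits x∈ y∈ y∉ e

      -- A subtree containing `a` takes in `b` as well, and the single edge from `b` to the placed
      -- nodes stays inside.
      exits-insert : ∀ {par S S′} → S′ ↭ b ∷ S → a ∈ₗ S → ExitsVia U par S → ExitsVia (b ∷ U) par S′
      exits-insert perm a∈ exits x∈ (here refl) y∉ e = ⊥-elim (y∉ (∈-resp-↭ (↭-sym perm) (here refl)))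
      exits-insert perm a∈ exits x∈ (there y∈) y∉ e with ∈-resp-↭ perm x∈
      ... | here refl = ⊥-elim (y∉ (∈-resp-↭ (↭-sym perm) (there (subst (_∈ₗ _) (sym (only y∈ (Edgeᵀ-sym e))) a∈))))
      ... | there x∈S = exits x∈S y∈ (λ y∈S → y∉ (∈-resp-↭ (↭-sym perm) (there y∈S))) e

      rooted-extend : ∀ {par} f → (∀ {x} → x ∈ₗ nodes f → x ∈ₗ U) → a ∉ₗ nodes f → Rooted U par f → Rooted (b ∷ U) par f
      rooted-extend nil _ _ _ = tt
      rooted-extend (cons j ks ss) f⊆ a∉ (exits , rk , rs) =
        exits-extend (f⊆ ∘ ∈-++⁺ˡ) (a∉ ∘ ∈-++⁺ˡ) exits ,
        rooted-extend ks (f⊆ ∘ there ∘ ∈-++⁺ˡ) (a∉ ∘ there ∘ ∈-++⁺ˡ) rk ,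
        rooted-extend ss (f⊆ ∘ ∈-++⁺ʳ (j ∷ nodes ks)) (a∉ ∘ ∈-++⁺ʳ (j ∷ nodes ks)) rs

      rooted-append : ∀ f → (∀ {x} → x ∈ₗ nodes f → x ∈ₗ U) → a ∉ₗ nodes f → Rooted U a f → Rooted (b ∷ U) a (append f b)
      rooted-append nil _ _ _ = leaf , tt , tt
        where
        leaf : ExitsVia (b ∷ U) a (b ∷ [])
        leaf (here refl) (here refl) y∉ e = ⊥-elim (y∉ (here refl))
        leaf (here refl) (there y∈) y∉ e = only y∈ (Edgeᵀ-sym e)
      rooted-append (cons j ks ss) f⊆ a∉ (exits , rk , rs) =
        exits-extend (f⊆ ∘ ∈-++⁺ˡ) (a∉ ∘ ∈-++⁺ˡ) exits ,
        rooted-extend ks (f⊆ ∘ there ∘ ∈-++⁺ˡ) (a∉ ∘ there ∘ ∈-++⁺ˡ) rk ,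
        rooted-append ss (f⊆ ∘ ∈-++⁺ʳ (j ∷ nodes ks)) (a∉ ∘ ∈-++⁺ʳ (j ∷ nodes ks)) rs

      rooted-insert : ∀ {par} f (p : a ∈ₗ nodes f) → (∀ {x} → x ∈ₗ nodes f → x ∈ₗ U) → Unique (nodes f) →
        Rooted U par f → Rooted (b ∷ U) par (insert f p b)
      rooted-insert (cons j ks ss) p f⊆ uniq (exits , rk , rs) with ∈-++⁻ (j ∷ nodes ks) p | unique-++⁻ (j ∷ nodes ks) uniq
      ... | inj₁ (here refl) | (uj@(_ ∷ _)) , _ , disj =
        exits-insert (↭-trans (prep j (nodes-append ks b)) (swap j b ↭-refl)) (here refl) exits ,
        rooted-append ks (f⊆ ∘ there ∘ ∈-++⁺ˡ) (Uniqueₚ.Unique[x∷xs]⇒x∉xs uj) rk ,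
        rooted-extend ss (f⊆ ∘ ∈-++⁺ʳ (j ∷ nodes ks)) (disj (here refl)) rs
      ... | inj₁ (there q) | (_ ∷ uk) , _ , disj =
        exits-insert (↭-trans (prep j (nodes-insert ks q b)) (swap j b ↭-refl)) (there q) exits ,
        rooted-insert ks q (f⊆ ∘ there ∘ ∈-++⁺ˡ) uk rk ,
        rooted-extend ss (f⊆ ∘ ∈-++⁺ʳ (j ∷ nodes ks)) (disj (there q)) rs
      ... | inj₂ q | _ , us , disj =
        exits-extend (f⊆ ∘ ∈-++⁺ˡ) (λ a∈ → disj a∈ q) exits ,
        rooted-extend ks (f⊆ ∘ there ∘ ∈-++⁺ˡ) (λ a∈ → disj (there a∈) q) rk ,
        rooted-insert ss q (f⊆ ∘ ∈-++⁺ʳ (j ∷ nodes ks)) us rs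

    Joined : List (Fin k) → Set
    Joined U = ∀ {x y} → x ∈ₗ U → y ∈ₗ U → ∃ λ xs → PathFromTo T x y xs × All (_∈ₗ U) xs

    linked-snoc : ∀ xs {a b} → Linked (Edge T) xs → last xs ≡ just a → Edge T a b → Linked (Edge T) (xs ++ b ∷ [])
    linked-snoc (x ∷ []) [-] refl e = e ∷ [-]
    linked-snoc (x ∷ y ∷ xs) (e₁ ∷ l) eq e = e₁ ∷ linked-snoc (y ∷ xs) l eq e

    last-snoc : ∀ (xs : List (Fin k)) b → last (xs ++ b ∷ []) ≡ just b
    last-snoc [] b = refl
    last-snoc (x ∷ []) b = refl
    last-snoc (x ∷ y ∷ xs) b = last-snoc (y ∷ xs) b

    last-cons : ∀ (x : Fin k) xs {y} → last xs ≡ just y → last (x ∷ xs) ≡ just y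
    last-cons x (y ∷ ys) eq = eq

    head-snoc : ∀ (xs : List (Fin k)) b {x} → head xs ≡ just x → head (xs ++ b ∷ []) ≡ just x
    head-snoc (x ∷ xs) b eq = eq

    linked-cons : ∀ {b a} xs → Edge T b a → head xs ≡ just a → Linked (Edge T) xs → Linked (Edge T) (b ∷ xs)
    linked-cons (x ∷ xs) e refl l = e ∷ l

    joined-add : ∀ {U a b} → Joined U → a ∈ₗ U → b ∉ₗ U → Edge T a b → Joined (b ∷ U)
    joined-add {b = b} J a∈ b∉ e (here refl) (here refl) =
        b ∷ [] , (([-] , [] ∷ [] , s≤s z≤n) , refl , refl) , here refl ∷ []
    joined-add {b = b} J a∈ b∉ e (here refl) (there y∈) with J a∈ y∈
    ... | xs , ((l , u , _) , h , z) , inU =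
      b ∷ xs , ((linked-cons xs (Edgeᵀ-sym e) h l , All.map (λ x∈ b≡x → b∉ (subst (_∈ₗ _) (sym b≡x) x∈)) inU ∷ u ,
          s≤s z≤n) , refl , last-cons b xs z) ,
      here refl ∷ All.map there inU
    joined-add {b = b} J a∈ b∉ e (there x∈) (here refl) with J x∈ a∈
    ... | xs , ((l , u , _) , h , z) , inU =
      xs ++ b ∷ [] , ((linked-snoc xs l z e ,
        Uniqueₚ.++⁺ u ([] ∷ []) (λ { (v∈ , here refl) → b∉ (All.lookup inU v∈) }) ,
        subst (1 ≤_) (sym (length-++ xs)) (≤-trans (s≤s z≤n) (m≤n+m 1 (length xs)))) , head-snoc xs b h , last-snoc xs b) ,
      Allₚ.++⁺ (All.map there inU) (here refl ∷ [])
    joined-add J a∈ b∉ e (there x∈) (there y∈) with J x∈ y∈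
    ... | xs , p , inU = xs , p , All.map there inU

    -- Two distinct neighbours of `b` would be joined by a path inside `U`; it avoids `b` and closes
    -- up to a cycle through `b`.
    unique-neighbour : Acyclic T → ∀ {U a a′ b} → Joined U → b ∉ₗ U → a ∈ₗ U → a′ ∈ₗ U → Edge T a b → Edge T a′ b → a ≡ a′
    unique-neighbour acyclic {U} {a} {a′} {b} J b∉ a∈ a′∈ e e′ with J a∈ a′∈
    ... | x ∷ [] , (_ , refl , refl) , _ = refl
    ... | xs@(x ∷ y ∷ zs) , ((l , u , _) , h , z) , inU = ⊥-elim (acyclic (b ∷ xs)
      ( linked-cons xs (Edgeᵀ-sym e) h l
      , All.map (λ x∈ b≡x → b∉ (subst (_∈ₗ U) (sym b≡x) x∈)) inU ∷ u
      , s≤s (s≤s (s≤s z≤n)) , b , a′ , refl , z , e′ ))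

    -- The list is an initial segment of the path of first children.
    data Chain : List (Fin k) → Forest → Set where
      []   : ∀ {f} → Chain [] f
      step : ∀ {h P ks ss} → Chain P ks → Chain (h ∷ P) (cons h ks ss)

    chain-append : ∀ {P} f b → Chain P f → Chain P (append f b)
    chain-append f b [] = []
    chain-append (cons h ks ss) b (step c) = step c

    chain-insert : ∀ {P} f {a} (p : a ∈ₗ nodes f) b → Chain P f → Chain P (insert f p b)
    chain-insert f p b [] = []
    chain-insert (cons h ks ss) p b (step c) with ∈-++⁻ (h ∷ nodes ks) p
    ... | inj₁ (here _)  = step (chain-append ks b c)
    ... | inj₁ (there q) = step (chain-insert ks q b c)
    ... | inj₂ q         = step c

    record Grown (r : Fin k) (P : List (Fin k)) : Set where
      field
        kids   : Forest
      U : List (Fin k)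
      U = r ∷ nodes kids
      field
        unique : Unique U
        rooted : Rooted U r kids
        joined : Joined U
        chain  : Chain P kids

    module _ (acyclic : Acyclic T) where

      grow : ∀ {r P a b} (g : Grown r P) → a ∈ₗ Grown.U g → b ∉ₗ Grown.U g → Edge T a b →
        ∃ λ (g′ : Grown r P) → Grown.U g′ ↭ b ∷ Grown.U g
      grow {r} {P} {a} {b} g a∈ b∉ e = result a∈ refl
        where
        open Grown g
        only : ∀ {x} → x ∈ₗ U → Edge T x b → x ≡ a
        only x∈ e′ = unique-neighbour acyclic joined b∉ x∈ a∈ e′ e
        build : ∀ ks → nodes ks ↭ b ∷ nodes kids → Rooted (b ∷ U) r ks → Chain P ks →
          ∃ λ (g′ : Grown r P) → Grown.U g′ ↭ b ∷ U
        build ks perm rooted′ chain′ = record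
          { kids   = ks
          ; unique = unique-↭ (↭-sym permU) (Allₚ.¬Any⇒All¬ U b∉ ∷ unique)
          ; rooted = rooted-⊆ ks (∈-resp-↭ permU) rooted′
          ; joined = λ x∈ y∈ → let xs , path , inU = joined-add joined a∈ b∉ e (∈-resp-↭ permU x∈) (∈-resp-↭ permU y∈) in
              xs , path , All.map (∈-resp-↭ (↭-sym permU)) inU
          ; chain  = chain′ } , permU
          where
          permU : r ∷ nodes ks ↭ b ∷ U
          permU = ↭-trans (prep r perm) (swap r b ↭-refl)
        tailU : ∀ {xs : List (Fin k)} {x} → Unique (x ∷ xs) → Unique xs
        tailU (_ ∷ u) = u
        result : ∀ {x} → x ∈ₗ U → x ≡ a → ∃ λ (g′ : Grown r P) → Grown.U g′ ↭ b ∷ U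
        result (here refl) refl = build (append kids b) (nodes-append kids b)
          (rooted-append b∉ only kids there (Uniqueₚ.Unique[x∷xs]⇒x∉xs unique) rooted) (chain-append kids b chain)
        result (there q) refl = build (insert kids q b) (nodes-insert kids q b)
          (rooted-insert b∉ only kids q there (tailU unique) rooted) (chain-insert kids q b chain)

      -- Along a path that starts in a placed node, every unplaced node is met from a placed
      -- neighbour, as `grow` requires.
      absorb : ∀ {r P y} xs → Linked (Edge T) xs → last xs ≡ just y → (g : Grown r P) →
          (∀ {x} → head xs ≡ just x → x ∈ₗ Grown.U g) →
        ∃ λ (g′ : Grown r P) → (∀ {x} → x ∈ₗ Grown.U g → x ∈ₗ Grown.U g′) × y ∈ₗ Grown.U g′
      absorb (x ∷ []) l refl g h∈ = g , (λ p → p) , h∈ refl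
      absorb (x ∷ x′ ∷ xs) (e ∷ l) eq g h∈ with x′ ∈ₗ? Grown.U g
      ... | yes x′∈ = absorb (x′ ∷ xs) l eq g (λ { refl → x′∈ })
      ... | no x′∉ with grow g (h∈ refl) x′∉ e
      ... | g₁ , perm with absorb (x′ ∷ xs) l eq g₁ (λ { refl → ∈-resp-↭ (↭-sym perm) (here refl) })
      ... | g₂ , sub , y∈ = g₂ , (λ p → sub (∈-resp-↭ (↭-sym perm) (there p))) , y∈

      absorb-all : Connected T → ∀ {r P} ys → (g : Grown r P) →
        ∃ λ (g′ : Grown r P) → (∀ {x} → x ∈ₗ Grown.U g → x ∈ₗ Grown.U g′) × (∀ {y} → y ∈ₗ ys → y ∈ₗ Grown.U g′)
      absorb-all conn [] g = g , (λ p → p) , λ ()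
      absorb-all conn {r} (y ∷ ys) g with conn r y
      ... | xs , (l , _) , h , z with absorb xs l z g (λ eq → here (sym (just-injective (trans (sym h) eq))))
      ... | g₁ , sub₁ , y∈ with absorb-all conn ys g₁
      ... | g₂ , sub₂ , ys∈ = g₂ , (λ p → sub₂ (sub₁ p)) , λ { (here refl) → sub₂ y∈ ; (there p) → ys∈ p }

      chainForest : List (Fin k) → Forest
      chainForest [] = nil
      chainForest (h ∷ P) = cons h (chainForest P) nil

      nodes-chain : ∀ P → nodes (chainForest P) ≡ P
      nodes-chain [] = refl
      nodes-chain (h ∷ P) = trans (++-identityʳ _) (cong (h ∷_) (nodes-chain P))

      chain-chain : ∀ P → Chain P (chainForest P)
      chain-chain [] = []
      chain-chain (h ∷ P) = step (chain-chain P)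

      path-joined : ∀ r P → Linked (Edge T) (r ∷ P) → Unique (r ∷ P) → Joined (r ∷ P)
      path-joined r [] l u (here refl) (here refl) = r ∷ [] , (([-] , [] ∷ [] , s≤s z≤n) , refl , refl) , here refl ∷ []
      path-joined r (h ∷ P) (e ∷ l) (p ∷ u) = joined-add (path-joined h P l u) (here refl) (Allₚ.All¬⇒¬Any p) (Edgeᵀ-sym e)

      path-rooted : ∀ r P → Linked (Edge T) (r ∷ P) → Unique (r ∷ P) → Rooted (r ∷ P) r (chainForest P)
      path-rooted r [] l u = tt
      path-rooted r (h ∷ P) (e ∷ l) (p ∷ u) =
        (λ { x∈ (here refl) y∉ e → refl ;
            x∈ (there y∈) y∉ e → ⊥-elim (y∉ (subst (λ z → _ ∈ₗ h ∷ z) (sym (nodes-chain P)) y∈)) }) ,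
        rooted-extend r∉ only (chainForest P) (λ x∈ → there (subst (_ ∈ₗ_) (nodes-chain P) x∈))
          (λ h∈ → Uniqueₚ.Unique[x∷xs]⇒x∉xs u (subst (h ∈ₗ_) (nodes-chain P) h∈)) (path-rooted h P l u) , tt
        where
        r∉ : r ∉ₗ h ∷ P
        r∉ = Allₚ.All¬⇒¬Any p
        only : ∀ {x} → x ∈ₗ h ∷ P → Edge T x r → x ≡ h
        only x∈ e′ = unique-neighbour acyclic (path-joined h P l u) r∉ x∈ (here refl) e′ (Edgeᵀ-sym e)

      -- The prescribed path is placed first, each node as an only child; everything else is added
      -- afterwards behind it.
      grown-path : ∀ r P → IsPath T (r ∷ P) → Grown r P
      grown-path r P (l , u , _) = record
        { kids   = chainForest P
        ; unique = subst (λ z → Unique (r ∷ z)) (sym (nodes-chain P)) u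
        ; rooted = subst (λ z → Rooted (r ∷ z) r (chainForest P)) (sym (nodes-chain P)) (path-rooted r P l u)
        ; joined = subst (λ z → Joined (r ∷ z)) (sym (nodes-chain P)) (path-joined r P l u)
        ; chain  = chain-chain P }

    -- Vertices and edges of `G` in the rooted decomposition.

    module Decomposition (dec : IsTreeDecomposition G T X) where

      open IsTreeDecomposition dec

      path-exits : ∀ {par S} → (∀ {x y} → x ∈ₗ S → y ∉ₗ S → Edge T x y → y ≡ par) →
        ∀ xs {i l} → Linked (Edge T) xs → head xs ≡ just i → last xs ≡ just l → i ∈ₗ S → l ∉ₗ S → par ∈ₗ xs
      path-exits exits (x ∷ []) _ refl refl i∈ l∉ = ⊥-elim (l∉ i∈)
      path-exits {S = S} exits (x ∷ y ∷ xs) (e ∷ lk) refl eq i∈ l∉ with y ∈ₗ? S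
      ... | yes y∈ = there (path-exits exits (y ∷ xs) lk refl eq y∈ l∉)
      ... | no y∉ = there (here (sym (exits i∈ y∉ e)))

      module _ {U : List (Fin k)} (total : ∀ y → y ∈ₗ U) where

        -- Every path from `i` to `l` has to leave `S` and does so through `par`, so coherence
        -- applies.
        crosses : ∀ {par S i l v} → ExitsVia U par S → i ∈ₗ S → l ∉ₗ S → v ∈ X i → v ∈ X l → v ∈ X par
        crosses {par} {i = i} {l} {v} exits i∈ l∉ = coherence i l par
          (λ { xs ((lk , _) , h , z) → path-exits (λ x∈ → exits x∈ (total _)) xs lk h z i∈ l∉ }) v

        -- With `tree⁻` this describes the vertices of a subtree through bags instead of the
        -- recursive list, the form in which the axioms of a tree decomposition can be applied.
        tree⁺ : ∀ par j ks {i v} → i ∈ₗ j ∷ nodes ks → v ∈ X i → v ∉ X par → v ∈ₗ new par j ++ verts j ks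
        verts⁺ : ∀ par f {i v} → i ∈ₗ nodes f → v ∈ X i → v ∉ X par → v ∈ₗ verts par f
        tree⁺ par j ks {i} {v} i∈ v∈ v∉ with v ∈? X j
        ... | yes v∈j = ∈-++⁺ˡ (∈-filter⁺ (λ v → (v ∈? X j) ×-dec ¬? (v ∈? X par)) (∈-allFin v) (v∈j , v∉))
        tree⁺ par j ks (here refl) v∈ v∉ | no v∉j = ⊥-elim (v∉j v∈)
        tree⁺ par j ks (there i∈) v∈ v∉ | no v∉j = ∈-++⁺ʳ (new par j) (verts⁺ j ks i∈ v∈ v∉j)
        verts⁺ par (cons j ks ss) i∈ v∈ v∉ with ∈-++⁻ (j ∷ nodes ks) i∈
        ... | inj₁ p = ∈-++⁺ˡ (tree⁺ par j ks p v∈ v∉)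
        ... | inj₂ p = ∈-++⁺ʳ (new par j ++ verts j ks) (verts⁺ par ss p v∈ v∉)

        tree⁻ : ∀ par j ks {v} → ExitsVia U par (j ∷ nodes ks) → Rooted U j ks → Unique (par ∷ j ∷ nodes ks) →
          v ∈ₗ new par j ++ verts j ks → (∃ λ i → i ∈ₗ j ∷ nodes ks × v ∈ X i) × v ∉ X par
        verts⁻ : ∀ par f {v} → Rooted U par f → Unique (par ∷ nodes f) →
          v ∈ₗ verts par f → (∃ λ i → i ∈ₗ nodes f × v ∈ X i) × v ∉ X par
        tree⁻ par j ks exits rk (p ∷ u) v∈ with ∈-++⁻ (new par j) v∈
        ... | inj₁ q with ∈-filter⁻ (λ v → (v ∈? X j) ×-dec ¬? (v ∈? X par)) {xs = allFin n} q
        ... | _ , v∈j , v∉ = (j , here refl , v∈j) , v∉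
        tree⁻ par j ks exits rk (p ∷ u) v∈ | inj₂ q with verts⁻ j ks rk u q
        ... | (i , i∈ , v∈i) , v∉j = (i , there i∈ , v∈i) ,
            λ v∈par → v∉j (below ks rk i∈ (λ par∈ → All.lookup p (there par∈) refl) v∈i v∈par)
          where
          -- `par` lies outside the forest below `j`, so a vertex shared by its bag and a bag of
          -- that forest is in `X j` too, contrary to `v∉j`.
          below : ∀ f {i l v} → Rooted U j f → i ∈ₗ nodes f → l ∉ₗ nodes f → v ∈ X i → v ∈ X l → v ∈ X j
          below (cons h hs ss) (ex , _ , rs) i∈ l∉ v∈ v∈′ with ∈-++⁻ (h ∷ nodes hs) i∈
          ... | inj₁ p = crosses ex p (l∉ ∘ ∈-++⁺ˡ) v∈ v∈′
          ... | inj₂ p = below ss rs p (l∉ ∘ ∈-++⁺ʳ (h ∷ nodes hs)) v∈ v∈′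
        verts⁻ par (cons j ks ss) (exits , rk , rs) (p ∷ u) v∈
            with ∈-++⁻ (new par j ++ verts j ks) v∈ | unique-++⁻ (j ∷ nodes ks) u
        ... | inj₁ q | uk , _ , _ with tree⁻ par j ks exits rk (All.tabulate (λ x∈ → All.lookup p (∈-++⁺ˡ x∈)) ∷ uk) q
        ... | (i , i∈ , v∈i) , v∉ = (i , ∈-++⁺ˡ i∈ , v∈i) , v∉
        verts⁻ par (cons j ks ss) (exits , rk , rs) (p ∷ u) v∈ | inj₂ q | _ , us , _
          with verts⁻ par ss rs (All.tabulate (λ x∈ → All.lookup p (∈-++⁺ʳ (j ∷ nodes ks) x∈)) ∷ us) q
        ... | (i , i∈ , v∈i) , v∉ = (i , ∈-++⁺ʳ (j ∷ nodes ks) i∈ , v∈i) , v∉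

        unique-tree : ∀ par j ks {ss} → Unique (par ∷ (j ∷ nodes ks) ++ ss) → Unique (par ∷ j ∷ nodes ks)
        unique-tree par j ks u = proj₁ (unique-++⁻ (par ∷ j ∷ nodes ks) u)

        unique-sibs : ∀ par xs {ss : List (Fin k)} → Unique (par ∷ xs ++ ss) → Unique (par ∷ ss)
        unique-sibs par xs (p ∷ u) = All.tabulate (λ x∈ → All.lookup p (∈-++⁺ʳ xs x∈)) ∷ proj₁ (proj₂ (unique-++⁻ xs u))

        separates : ∀ par f → Rooted U par f → Unique (par ∷ nodes f) → Separates par f
        separates par nil _ _ = tt
        separates par (cons j ks ss) (exits , rk , rs) u =
          leaves , separates j ks rk (proj₂-unique (unique-tree par j ks u)) ,
              separates par ss rs (unique-sibs par (j ∷ nodes ks) u)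
          where
          proj₂-unique : ∀ {x : Fin k} {xs} → Unique (x ∷ xs) → Unique xs
          proj₂-unique (_ ∷ u) = u
          leaves : LeavesVia par (new par j ++ verts j ks)
          leaves {a} {b} a∈ b∉ e with coverE a b e | tree⁻ par j ks exits rk (unique-tree par j ks u) a∈
          ... | l , a∈l , b∈l | (i , i∈ , a∈i) , a∉ with l ∈ₗ? (j ∷ nodes ks)
          -- A bag `l` outside the subtree that contains the edge would force `a` into the bag of
          -- `par`.
          ... | no l∉ = ⊥-elim (a∉ (crosses exits i∈ l∉ a∈i a∈l))
          ... | yes l∈ with b ∈? X par
          ... | yes b∈ = b∈
          ... | no b∉par = ⊥-elim (b∉ (tree⁺ par j ks l∈ b∈l b∉par))

        unique-verts : ∀ par f → Rooted U par f → Unique (par ∷ nodes f) → Unique (verts par f)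
        unique-verts par nil _ _ = []
        unique-verts par (cons j ks ss) (exits , rk , rs) u = Uniqueₚ.++⁺
          (Uniqueₚ.++⁺ (Uniqueₚ.filter⁺ (λ v → (v ∈? X j) ×-dec ¬? (v ∈? X par)) (Uniqueₚ.allFin⁺ n))
              (unique-verts j ks rk uk)
            (λ { (v∈ , v∈′) → proj₂ (verts⁻ j ks rk uk v∈′) (new⊆ par j v∈) }))
          (unique-verts par ss rs (unique-sibs par (j ∷ nodes ks) u))
          λ { (v∈ , v∈′) → let (i , i∈ , v∈i) , v∉ = tree⁻ par j ks exits rk ut v∈
                               (l , l∈ , v∈l) , _ = verts⁻ par ss rs (unique-sibs par (j ∷ nodes ks) u) v∈′
                           in v∉ (crosses exits i∈ (λ l∈tree → disj (there l∈tree) l∈) v∈i v∈l) }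
          where
          ut : Unique (par ∷ j ∷ nodes ks)
          ut = unique-tree par j ks u
          uk : Unique (j ∷ nodes ks)
          uk with ut
          ... | _ ∷ u = u
          disj : ∀ {x} → x ∈ₗ par ∷ j ∷ nodes ks → x ∉ₗ nodes ss
          disj = proj₂ (proj₂ (unique-++⁻ (par ∷ j ∷ nodes ks) u))

      root-bag : Fin k → List (Fin n)
      root-bag r = filter (_∈? X r) (allFin n)

      owns : List Block → List (Fin n)
      owns [] = []
      owns (b ∷ bs) = Block.own b ++ owns bs

      length-owns : ∀ bs → length (owns bs) ≡ ow bs
      length-owns [] = refl
      length-owns (b ∷ bs) = trans (length-++ (Block.own b)) (cong (length (Block.own b) +_) (length-owns bs))

      owns-first : ∀ o h ks o⊆ sep uniq {v} → v ∈ₗ o → v ∈ₗ owns (spine o h ks o⊆ sep uniq)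
      owns-first o h nil o⊆ sep uniq v∈ = ∈-++⁺ˡ v∈
      owns-first o h (cons _ _ _) o⊆ sep uniq v∈ = ∈-++⁺ˡ v∈

      -- A vertex of a path bag is owned by the topmost path node containing it. If it is already in
      -- `X h`, that node is `h` or lies above it, so the decision is handed back to the caller.
      chain-owns : ∀ o h ks o⊆ sep uniq {P i v} → Chain P ks → i ∈ₗ P → v ∈ X i →
        v ∈ X h ⊎ v ∈ₗ owns (spine o h ks o⊆ sep uniq)
      chain-owns o h (cons j ks ss) o⊆ sep uniq {v = v} (step c) i∈ v∈ with v ∈? X h
      ... | yes v∈h = inj₁ v∈h
      ... | no v∉h = inj₂ (∈-++⁺ʳ o (later i∈))
        where
        in-new : v ∈ X j → v ∈ₗ new h j
        in-new v∈j = ∈-filter⁺ (λ v → (v ∈? X j) ×-dec ¬? (v ∈? X h)) (∈-allFin v) (v∈j , v∉h)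
        later : _ ∈ₗ j ∷ _ → v ∈ₗ owns (spine (new h j) j ks _ (proj₁ (proj₂ sep)) _)
        later (here refl) = owns-first (new h j) j ks _ _ _ (in-new v∈)
        later (there i∈) with chain-owns (new h j) j ks _ _ _ c i∈ v∈
        ... | inj₁ v∈j = owns-first (new h j) j ks _ _ _ (in-new v∈j)
        ... | inj₂ q = q

      record PathBlocks (P : List (Fin k)) : Set where
        field
          blocks   : List Block
          cyclic   : Cyclic blocks
          all-once : flatten blocks ↭ allFin n
          covered  : ∀ {i v} → i ∈ₗ P → v ∈ X i → v ∈ₗ owns blocks

      path-blocks : ∀ r P → IsPath T (r ∷ P) → PathBlocks (r ∷ P)
      path-blocks r P path with absorb-all (proj₂ tree) (proj₁ tree) (allFin k) (grown-path (proj₂ tree) r P path)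
      ... | g , _ , all∈ = record
        { blocks   = spine o r kids o⊆ sep uniq
        ; cyclic   = spine-cyclic o r kids o⊆ sep uniq
        ; all-once = ↭-trans (flatten-spine o r kids o⊆ sep uniq)
            (∼bag⇒↭ (unique∧set⇒bag uniq (Uniqueₚ.allFin⁺ n) (mk⇔ (λ _ → ∈-allFin _) (λ _ → complete _))))
        ; covered  = in-owns }
        where
        open Grown g
        total : ∀ y → y ∈ₗ U
        total y = all∈ (∈-allFin y)
        o = root-bag r
        o⊆ : All (_∈ X r) o
        o⊆ = All.tabulate (λ v∈ → proj₂ (∈-filter⁻ (_∈? X r) {xs = allFin n} v∈))
        sep = separates total r kids rooted unique
        uniq : Unique (o ++ verts r kids)
        uniq = Uniqueₚ.++⁺ (Uniqueₚ.filter⁺ (_∈? X r) (Uniqueₚ.allFin⁺ n)) (unique-verts total r kids rooted unique)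
          λ { (v∈ , v∈′) → proj₂ (verts⁻ total r kids rooted unique v∈′) (All.lookup o⊆ v∈) }
        complete : ∀ v → v ∈ₗ o ++ verts r kids
        complete v with v ∈? X r | coverV v
        ... | yes v∈ | _ = ∈-++⁺ˡ (∈-filter⁺ (_∈? X r) (∈-allFin v) v∈)
        ... | no v∉ | i , v∈i with total i
        ... | here refl = ⊥-elim (v∉ v∈i)
        ... | there i∈ = ∈-++⁺ʳ o (verts⁺ total r kids i∈ v∈i v∉)
        first : ∀ {v} → v ∈ X r → v ∈ₗ owns (spine o r kids o⊆ sep uniq)
        first v∈ = owns-first o r kids o⊆ sep uniq (∈-filter⁺ (_∈? X r) (∈-allFin _) v∈)
        in-owns : ∀ {i v} → i ∈ₗ r ∷ P → v ∈ X i → v ∈ₗ owns (spine o r kids o⊆ sep uniq)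
        in-owns (here refl) v∈ = first v∈
        in-owns (there i∈) v∈ with chain-owns o r kids o⊆ sep uniq chain i∈ v∈
        ... | inj₁ v∈r = first v∈r
        ... | inj₂ q = q

-- Counting

∑ : ∀ {A : Set} → List A → (A → ℕ) → ℕ
∑ xs f = sum (map f xs)

∑-cong : ∀ {A : Set} xs {f g : A → ℕ} → (∀ x → f x ≡ g x) → ∑ xs f ≡ ∑ xs g
∑-cong xs eq = cong sum (map-cong eq xs)

∑-mono : ∀ {A : Set} xs {f g : A → ℕ} → (∀ x → f x ≤ g x) → ∑ xs f ≤ ∑ xs g
∑-mono [] le = z≤n
∑-mono (x ∷ xs) le = +-mono-≤ (le x) (∑-mono xs le)

∑-+ : ∀ {A : Set} xs (f g : A → ℕ) → ∑ xs (λ x → f x + g x) ≡ ∑ xs f + ∑ xs g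
∑-+ [] f g = refl
∑-+ (x ∷ xs) f g = trans (cong (f x + g x +_) (∑-+ xs f g)) (ring (f x) (g x) (∑ xs f) (∑ xs g))
  where
  ring : ∀ a b c d → a + b + (c + d) ≡ a + c + (b + d)
  ring = solve-∀

∑-*ˡ : ∀ {A : Set} c xs (f : A → ℕ) → ∑ xs (λ x → c * f x) ≡ c * ∑ xs f
∑-*ˡ c [] f = sym (*-zeroʳ c)
∑-*ˡ c (x ∷ xs) f = trans (cong (c * f x +_) (∑-*ˡ c xs f)) (sym (*-distribˡ-+ c (f x) (∑ xs f)))

∑-zero : ∀ {A : Set} (xs : List A) → ∑ xs (λ _ → 0) ≡ 0
∑-zero [] = refl
∑-zero (x ∷ xs) = ∑-zero xs

∑-swap : ∀ {A B : Set} (xs : List A) (ys : List B) (f : A → B → ℕ) →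
  ∑ xs (λ x → ∑ ys (f x)) ≡ ∑ ys (λ y → ∑ xs (λ x → f x y))
∑-swap [] ys f = sym (∑-zero ys)
∑-swap (x ∷ xs) ys f = trans (cong (∑ ys (f x) +_) (∑-swap xs ys f)) (sym (∑-+ ys (f x) _))

∑-const : ∀ {A : Set} (xs : List A) {f : A → ℕ} {c} → (∀ x → f x ≤ c) → ∑ xs f ≤ length xs * c
∑-const [] le = z≤n
∑-const (x ∷ xs) le = +-mono-≤ (le x) (∑-const xs le)

∑-positive : ∀ {A : Set} {xs : List A} {f : A → ℕ} → Any (λ x → 1 ≤ f x) xs → 1 ≤ ∑ xs f
∑-positive (here p) = ≤-trans p (m≤m+n _ _)
∑-positive (there p) = ≤-trans (∑-positive p) (m≤n+m _ _)

ind : Bool → ℕ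
ind true = 1
ind false = 0

count-∑ : ∀ {n} (f : Fin n → Bool) → count f ≡ ∑ (allFin n) (ind ∘ f)
count-∑ {n} f = go (allFin n)
  where
  go : ∀ xs → length (filter (λ i → Bool._≟_ (f i) true) xs) ≡ ∑ xs (ind ∘ f)
  go [] = refl
  go (x ∷ xs) with f x
  ... | true = cong suc (go xs)
  ... | false = go xs

card-count : ∀ {n} (S : Subset n) → ∣ S ∣ ≡ count (inB S)
card-count S = trans (go S) (trans (cong sum (sym (map-tabulate id (ind ∘ lookup S)))) (sym (count-∑ (inB S))))
  where
  go : ∀ {n} (S : Subset n) → ∣ S ∣ ≡ sum (tabulate (ind ∘ lookup S))
  go [] = refl
  go (true ∷ S) = cong suc (go S)
  go (false ∷ S) = go S

card-≤ : ∀ {n} (S : Subset n) xs → (∀ {v} → v ∈ S → v ∈ₗ xs) → ∣ S ∣ ≤ length xs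
card-≤ {n} S xs sub = subst (_≤ length xs) (sym (card-count S))
  (unique-length (Uniqueₚ.filter⁺ S? (Uniqueₚ.allFin⁺ n))
      λ v∈ → sub (lookup⇒[]= _ S (proj₂ (∈-filter⁻ S? {xs = allFin n} v∈))))
  where S? = λ i → Bool._≟_ (inB S i) true

card-≥ : ∀ {n} (S : Subset n) xs → Unique xs → (∀ {v} → v ∈ₗ xs → v ∈ S) → length xs ≤ ∣ S ∣
card-≥ {n} S xs uniq sub = subst (length xs ≤_) (sym (card-count S))
  (unique-length uniq λ v∈ → ∈-filter⁺ (λ i → Bool._≟_ (inB S i) true) (∈-allFin _) ([]=⇒lookup (sub v∈)))

≤-foldr-⊔ : ∀ {A : Set} (f : A → ℕ) {x} xs → x ∈ₗ xs → f x ≤ foldr _⊔_ 0 (map f xs)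
≤-foldr-⊔ f (x ∷ xs) (here refl) = m≤m⊔n _ _
≤-foldr-⊔ f (x ∷ xs) (there p) = ≤-trans (≤-foldr-⊔ f xs p) (m≤n⊔m _ _)

degree-≤ : ∀ {n} (G : Graph n) v → degree G v ≤ maxDegree G
degree-≤ G v = ≤-foldr-⊔ (degree G) (allFin _) (∈-allFin v)

bag-≤ : ∀ {n k} (X : Fin k → Subset n) i → ∣ X i ∣ ≤ maxBag X
bag-≤ X i = ≤-foldr-⊔ (λ i → ∣ X i ∣) (allFin _) (∈-allFin i)

module _ {n k} (G : Graph n) (X : Fin k → Subset n) (B : Subset n) where

  private
    V = allFin n
    a : Fin n → Fin n → ℕ
    a u v = ind (adj G u v)
    x : Fin k → Fin n → ℕ
    x c u = ind (inB (X c) u)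
    b b̄ : Fin n → ℕ
    b u = ind (inB B u)
    b̄ u = ind (not (inB B u))

  -- Each summand tests one end only, so the double sum reduces to degrees. As `b` and `b̄` are
  -- complementary, every vertex of the bag is charged its degree once, which gives one factor of
  -- the maximum degree and not two.
  touching : Fin k → Fin n → Fin n → ℕ
  touching c u v = x c u * b u * a u v + x c v * b̄ v * a v u

  touching-total : ∀ c → ∑ V (λ u → ∑ V (touching c u)) ≤ maxBag X * maxDegree G
  touching-total c = begin
    ∑ V (λ u → ∑ V (touching c u))
      ≡⟨ ∑-cong V (λ u → ∑-+ V (λ v → x c u * b u * a u v) (λ v → x c v * b̄ v * a v u)) ⟩
    ∑ V (λ u → ∑ V (λ v → x c u * b u * a u v) + ∑ V (λ v → x c v * b̄ v * a v u))
      ≡⟨ ∑-+ V _ _ ⟩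
    ∑ V (λ u → ∑ V (λ v → x c u * b u * a u v)) + ∑ V (λ u → ∑ V (λ v → x c v * b̄ v * a v u))
      ≡⟨ cong₂ _+_ (∑-cong V (λ u → ∑-*ˡ (x c u * b u) V (a u)))
           (trans (∑-swap V V (λ u v → x c v * b̄ v * a v u)) (∑-cong V (λ v → ∑-*ˡ (x c v * b̄ v) V (a v)))) ⟩
    ∑ V (λ u → x c u * b u * ∑ V (a u)) + ∑ V (λ u → x c u * b̄ u * ∑ V (a u))
      ≡⟨ sym (∑-+ V _ _) ⟩
    ∑ V (λ u → x c u * b u * ∑ V (a u) + x c u * b̄ u * ∑ V (a u))
      ≤⟨ ∑-mono V per-vertex ⟩
    ∑ V (λ u → maxDegree G * x c u)
      ≡⟨ ∑-*ˡ (maxDegree G) V (x c) ⟩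
    maxDegree G * ∑ V (x c)
      ≡⟨ cong (maxDegree G *_) (sym (trans (card-count (X c)) (count-∑ (inB (X c))))) ⟩
    maxDegree G * ∣ X c ∣
      ≤⟨ *-monoʳ-≤ (maxDegree G) (bag-≤ X c) ⟩
    maxDegree G * maxBag X
      ≡⟨ *-comm (maxDegree G) (maxBag X) ⟩
    maxBag X * maxDegree G ∎
    where
    open ≤-Reasoning
    ring : ∀ x b b̄ d → x * b * d + x * b̄ * d ≡ (b + b̄) * d * x
    ring = solve-∀
    both : ∀ u → b u + b̄ u ≡ 1
    both u with inB B u
    ... | true = refl
    ... | false = refl
    per-vertex : ∀ u → x c u * b u * ∑ V (a u) + x c u * b̄ u * ∑ V (a u) ≤ maxDegree G * x c u
    per-vertex u = begin
      x c u * b u * ∑ V (a u) + x c u * b̄ u * ∑ V (a u) ≡⟨ ring (x c u) (b u) (b̄ u) (∑ V (a u)) ⟩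
      (b u + b̄ u) * ∑ V (a u) * x c u                    ≡⟨ cong (λ z → z * ∑ V (a u) * x c u) (both u) ⟩
      1 * ∑ V (a u) * x c u                              ≡⟨ cong (_* x c u) (*-identityˡ (∑ V (a u))) ⟩
      ∑ V (a u) * x c u                                  ≡⟨ cong (_* x c u) (sym (count-∑ (adj G u))) ⟩
      degree G u * x c u                                 ≤⟨ *-monoˡ-≤ (x c u) (degree-≤ G u) ⟩
      maxDegree G * x c u                                ∎

  edgesBetween-≤ : ∀ cs → (∀ {u v} → inB B u ≡ true → inB B v ≡ false → Edge G u v → Any (λ c → u ∈ X c ⊎ v ∈ X c) cs) →
    edgesBetween G B ≤ length cs * (maxBag X * maxDegree G)
  edgesBetween-≤ cs covers = begin
    edgesBetween G B                                  ≡⟨ ∑-cong V (λ u → count-∑ (λ v → cross u v)) ⟩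
    ∑ V (λ u → ∑ V (λ v → ind (cross u v)))           ≤⟨ ∑-mono V (λ u → ∑-mono V (λ v → pointwise u v)) ⟩
    ∑ V (λ u → ∑ V (λ v → ∑ cs (λ c → touching c u v))) ≡⟨ ∑-cong V (λ u → ∑-swap V cs (λ v c → touching c u v)) ⟩
    ∑ V (λ u → ∑ cs (λ c → ∑ V (touching c u)))       ≡⟨ ∑-swap V cs (λ u c → ∑ V (touching c u)) ⟩
    ∑ cs (λ c → ∑ V (λ u → ∑ V (touching c u)))       ≤⟨ ∑-const cs touching-total ⟩
    length cs * (maxBag X * maxDegree G)              ∎
    where
    open ≤-Reasoning
    cross : Fin n → Fin n → Bool
    cross u v = inB B u ∧ (not (inB B v) ∧ adj G u v)
    hit : ∀ {u v c} → inB B u ≡ true → inB B v ≡ false → adj G u v ≡ true → u ∈ X c ⊎ v ∈ X c → 1 ≤ touching c u v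
    hit {u} {v} {c} bu bv e (inj₁ u∈) rewrite []=⇒lookup u∈ | bu | e = s≤s z≤n
    hit {u} {v} {c} bu bv e (inj₂ v∈) rewrite []=⇒lookup v∈ | bv | trans (Graph.sym G v u) e = m≤n+m 1 _
    pointwise : ∀ u v → ind (cross u v) ≤ ∑ cs (λ c → touching c u v)
    pointwise u v = go (inB B u) (inB B v) (adj G u v) refl refl refl
      where
      go : ∀ p q r → inB B u ≡ p → inB B v ≡ q → adj G u v ≡ r →
        ind (p ∧ (not q ∧ r)) ≤ ∑ cs (λ c → touching c u v)
      go false _ _ _ _ _ = z≤n
      go true true _ _ _ _ = z≤n
      go true false false _ _ _ = z≤n
      go true false true bu bv e =
        ∑-positive (Any.map (hit bu bv e) (covers bu bv (subst T (sym e) tt)))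

-- A path of `T` whose bags have the largest union.

isPath? : ∀ {k} (T : Graph k) xs → Dec (IsPath T xs)
isPath? T xs = linked? (λ u v → T? (adj T u v)) xs ×-dec DecUnique.unique? _≟_ xs ×-dec (1 ≤? length xs)

lists≤ : ∀ k → ℕ → List (List (Fin k))
lists≤ k zero = [] ∷ []
lists≤ k (suc d) = [] ∷ cartesianProductWith _∷_ (allFin k) (lists≤ k d)

∈-lists≤ : ∀ {k} xs d → length xs ≤ d → xs ∈ₗ lists≤ k d
∈-lists≤ [] zero _ = here refl
∈-lists≤ [] (suc d) _ = here refl
∈-lists≤ (x ∷ xs) (suc d) (s≤s le) = there (∈-cartesianProductWith⁺ _∷_ (∈-allFin x) (∈-lists≤ xs d le))

-- Nodes of a path are distinct, so every path has at most `k` of them and occurs in a finite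
-- enumeration.
maximal-path : ∀ {k} (T : Graph k) (f : List (Fin k) → ℕ) → Fin k →
  ∃ λ P → IsPath T P × (∀ Q → IsPath T Q → f Q ≤ f P)
maximal-path {k} T f i = argmax f (i ∷ []) paths ,
  argmax-all f ([-] , [] ∷ [] , s≤s z≤n) (Allₚ.all-filter (isPath? T) (lists≤ k k)) ,
  λ Q path → All.lookup (f[xs]≤f[argmax] (i ∷ []) paths) (∈-filter⁺ (isPath? T) (∈-lists≤ Q k (short Q path)) path)
  where
  paths = filter (isPath? T) (lists≤ k k)
  short : ∀ Q → IsPath T Q → length Q ≤ k
  short Q (_ , u , _) = subst (length Q ≤_) (length-tabulate (λ i → i)) (unique-length u (λ _ → ∈-allFin _))

∈-union⁻ : ∀ {n k} (X : Fin k → Subset n) P {v} → v ∈ foldr _∪_ ∅ (map X P) → ∃ λ i → i ∈ₗ P × v ∈ X i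
∈-union⁻ X [] v∈ = ⊥-elim (∉⊥ v∈)
∈-union⁻ X (i ∷ P) v∈ with x∈p∪q⁻ (X i) _ v∈
... | inj₁ p = i , here refl , p
... | inj₂ p with ∈-union⁻ X P p
... | j , j∈ , q = j , there j∈ , q

-- Lists of vertices as subsets.

module _ {n : ℕ} where

  toSubset : List (Fin n) → Subset n
  toSubset xs = tabulateᵛ (λ v → does (v ∈ₗ? xs))

  inB-toSubset : ∀ xs v → inB (toSubset xs) v ≡ does (v ∈ₗ? xs)
  inB-toSubset xs v = lookup∘tabulate (λ v → does (v ∈ₗ? xs)) v

  toSubset⁺ : ∀ xs {v} → v ∈ₗ xs → v ∈ toSubset xs
  toSubset⁺ xs {v} v∈ = lookup⇒[]= v _ (trans (inB-toSubset xs v) (dec-true (v ∈ₗ? xs) v∈))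

  inB-toSubset⁻ : ∀ xs {v} → inB (toSubset xs) v ≡ true → v ∈ₗ xs
  inB-toSubset⁻ xs {v} eq with v ∈ₗ? xs | inB-toSubset xs v
  ... | yes v∈ | _ = v∈
  ... | no _ | eq′ with () ← trans (sym eq) eq′

  inB-toSubset-false : ∀ xs {v} → inB (toSubset xs) v ≡ false → v ∉ₗ xs
  inB-toSubset-false xs {v} eq v∈ with () ← trans (sym eq) ([]=⇒lookup (toSubset⁺ xs v∈))

  card-toSubset : ∀ xs → Unique xs → ∣ toSubset xs ∣ ≡ length xs
  card-toSubset xs u = ≤-antisym (card-≤ (toSubset xs) xs (λ v∈ → inB-toSubset⁻ xs ([]=⇒lookup v∈)))
    (card-≥ (toSubset xs) xs u (toSubset⁺ xs))

-- By contraposition: if the inequality failed for some path, `p / q` would exceed the logarithm of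
-- `n / R`, and `LogBound` would then contradict the assumed lower bound on `2 * e`.
boundedByLogExpr : ∀ {n k} (T : Graph k) (X : Fin k → Subset n) t Δ e {R K} →
  (∀ P → IsPath T P → unionSize X P ≤ R) → LogBound n R K → e ≤ K * (t * Δ) → BoundedByLogExpr T X t Δ e
boundedByLogExpr {n} T X t Δ e {R} {K} maximal bound e≤ p q 1≤q lt P path = ≮⇒≥ λ n<u → <⇒≱ lt (begin
  2 * e * (q * q)                              ≤⟨ *-monoˡ-≤ (q * q) (*-monoʳ-≤ 2 e≤) ⟩
  2 * (K * (t * Δ)) * (q * q)                  ≡⟨ ring K (t * Δ) (q * q) ⟩
  t * Δ * (2 * K * (q * q))                    ≤⟨ *-monoʳ-≤ (t * Δ)
      (bound p q 1≤q (<-≤-trans n<u (*-monoʳ-≤ (2 ^ p) (^-monoˡ-≤ q (maximal P path))))) ⟩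
  t * Δ * (p * p + 9 * p * q + 8 * q * q)      ∎)
  where
  open ≤-Reasoning
  ring : ∀ K d s → 2 * (K * d) * s ≡ d * (2 * K * s)
  ring = solve-∀

theorem4p1 : ∀ (n : ℕ) (G : Graph n) (k : ℕ) (T : Graph k) (X : Fin k → Subset n)
    → IsTreeDecomposition G T X
    → ∀ (t : ℕ) → maxBag X ≡ t
    → ∀ (m : ℕ) → 1 ≤ m → m ≤ n
    → ∃ λ (B : Subset n) → ∣ B ∣ ≡ m
    × BoundedByLogExpr T X t (maxDegree G) (edgesBetween G B)
-- As `1 ≤ n`, there is a vertex; a node whose bag contains it starts the search for a path and
-- later shows that the own vertices are not empty.
theorem4p1 n G k T X dec t refl m 1≤m m≤n with IsTreeDecomposition.coverV dec (fromℕ< (≤-trans 1≤m m≤n))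
... | i , v∈ with maximal-path T (unionSize X) i
... | [] , (_ , _ , ()) , _
... | r ∷ P , path , maximal = toSubset B ,
  trans (card-toSubset B (proj₁ (unique-++⁻ B (unique-↭ (↭-sym all) (Uniqueₚ.allFin⁺ n))))) sizeB ,
  boundedByLogExpr T X (maxBag X) (maxDegree G) (edgesBetween G (toSubset B)) {ow blocks} {length bags}
    (λ Q q → ≤-trans (maximal Q q) union≤)
    (subst (λ N → LogBound N (ow blocks) (length bags)) tot≡n bound)
    (edgesBetween-≤ G X (toSubset B) bags (λ u∈ v∉ e → covers (inB-toSubset⁻ B u∈) (inW (inB-toSubset-false B v∉)) e))
  where
  open Cutting G X
  open Rooting T
  open Decomposition dec
  open PathBlocks (path-blocks r P path)
  union≤ : unionSize X (r ∷ P) ≤ ow blocks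
  union≤ = subst (unionSize X (r ∷ P) ≤_) (length-owns blocks)
    (card-≤ _ (owns blocks) (λ v∈ → let _ , i∈ , v∈i = ∈-union⁻ X (r ∷ P) v∈ in covered i∈ v∈i))
  1≤R : 1 ≤ ow blocks
  1≤R = ≤-trans (card-≥ _ (_ ∷ []) ([] ∷ []) (λ { (here refl) → x∈p∪q⁺ (inj₁ v∈) }))
          (≤-trans (maximal (i ∷ []) ([-] , [] ∷ [] , s≤s z≤n)) union≤)
  tot≡n : tot blocks ≡ n
  tot≡n = trans (sym (length-flatten blocks)) (trans (↭-length all-once) (length-tabulate (λ i → i)))
  open Solution (solve-blocks blocks cyclic 1≤R m (subst (m ≤_) (sym tot≡n) m≤n))
  all : B ++ W ↭ allFin n
  all = ↭-trans perm all-once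
  inW : ∀ {v} → v ∉ₗ B → v ∈ₗ W
  inW {v} v∉ with ∈-++⁻ B (∈-resp-↭ (↭-sym all) (∈-allFin v))
  ... | inj₁ p = ⊥-elim (v∉ p)
  ... | inj₂ p = p
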